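{- Suppose that $G$ is a noncyclotomic nonbipartite graph containing a vertex $v$ such that the induced subgraph on $V(G)\setminus\{v\}$ is cyclotomic. Suppose also that $G$ is a line graph. Then $G$ is a Salem graph.
   Context: Graphs are finite simple graphs; eigenvalues are those of the adjacency matrix. A graph is cyclotomic if all its eigenvalues lie in $[-2,2]$. A line graph is a graph $L(H)$ whose vertices are the edges of some graph $H$, two being adjacent iff the edges share a vertex. A nonbipartite graph is a Salem graph if it has exactly one eigenvalue $\lambda>2$ and no eigenvalues in $(-\infty,-2)$. -}

module Defs where

open import Level using (0ℓ)
open import Algebra.Bundles.Raw using (RawMonoid)
import Algebra.Definitions.RawMonoid as Monoid
open import Data.Bool.Base using (Bool; if_then_else_)
open import Data.Nat.Base as ℕ using (ℕ; suc; _⊔_)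
import Data.Nat.Properties as ℕ
open import Data.Fin.Base as Fin using (Fin; punchIn)
open import Data.Fin.Properties using (any?) renaming (_≟_ to _≟ᶠ_)
open import Data.Integer.Base using (+_; -[1+_])
open import Data.Product.Base using (Σ; ∃-syntax; _×_; _,_)
open import Data.Rational.Base as ℚ using (ℚ; 0ℚ; 1ℚ; ½)
import Data.Rational.Properties as ℚ
open import Data.Rational.Solver using (module +-*-Solver)
open import Data.Sum.Base using (_⊎_)
open import Data.Vec.Functional using (Vector)
open import Function.Base using (_∘_)
open import Function.Bundles using (_⇔_; _↔_; Inverse)
open import Relation.Binary.Core using (Rel)
open import Relation.Binary.Definitions using (Decidable; Symmetric; Irreflexive; DecidableEquality)
open import Relation.Binary.PropositionalEquality
  using (_≡_; _≢_; refl; sym; trans; cong; subst)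
open import Relation.Nullary using (¬_; does)
open import Relation.Nullary.Decidable using (_×-dec_; _⊎-dec_; ¬?; map′)

-- Real numbers are Cauchy sequences of rationals; their equality is the
-- setoid relation _≈_ below.
IsCauchy : (ℕ → ℚ) → Set
IsCauchy s = ∀ ε → 0ℚ ℚ.< ε →
  ∃[ N ] ∀ m n → N ℕ.≤ m → N ℕ.≤ n → ℚ.∣ s m ℚ.- s n ∣ ℚ.< ε

record ℝ : Set where
  constructor mkℝ
  field
    seq    : ℕ → ℚ
    cauchy : IsCauchy seq

open ℝ public

private abstract
  half-pos : ∀ {ε} → 0ℚ ℚ.< ε → 0ℚ ℚ.< ½ ℚ.* ε
  half-pos {ε} 0<ε =
    subst (ℚ._< ½ ℚ.* ε) (ℚ.*-zeroʳ ½) (ℚ.*-monoʳ-<-pos ½ 0<ε)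

  halves : ∀ ε → ½ ℚ.* ε ℚ.+ ½ ℚ.* ε ≡ ε
  halves ε = trans (sym (ℚ.*-distribʳ-+ ε ½ ½)) (ℚ.*-identityˡ ε)

  ∣p-p∣≡0 : ∀ p → ℚ.∣ p ℚ.- p ∣ ≡ 0ℚ
  ∣p-p∣≡0 p = cong ℚ.∣_∣ (ℚ.+-inverseʳ p)

  +-cauchy : ∀ {s t} → IsCauchy s → IsCauchy t → IsCauchy (λ n → s n ℚ.+ t n)
  +-cauchy {s} {t} cs ct ε 0<ε
    with M , p ← cs (½ ℚ.* ε) (half-pos 0<ε)
       | N , q ← ct (½ ℚ.* ε) (half-pos 0<ε) = M ⊔ N , λ m n m≥ n≥ →
    let open ℚ.≤-Reasoning in begin-strict
      ℚ.∣ (s m ℚ.+ t m) ℚ.- (s n ℚ.+ t n) ∣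
        ≡⟨ cong ℚ.∣_∣ (rearrange (s m) (t m) (s n) (t n)) ⟩
      ℚ.∣ (s m ℚ.- s n) ℚ.+ (t m ℚ.- t n) ∣
        ≤⟨ ℚ.∣p+q∣≤∣p∣+∣q∣ (s m ℚ.- s n) (t m ℚ.- t n) ⟩
      ℚ.∣ s m ℚ.- s n ∣ ℚ.+ ℚ.∣ t m ℚ.- t n ∣
        <⟨ ℚ.+-mono-< (p m n (ℕ.m⊔n≤o⇒m≤o M N m≥) (ℕ.m⊔n≤o⇒m≤o M N n≥))
                      (q m n (ℕ.m⊔n≤o⇒n≤o M N m≥) (ℕ.m⊔n≤o⇒n≤o M N n≥)) ⟩
      ½ ℚ.* ε ℚ.+ ½ ℚ.* ε
        ≡⟨ halves ε ⟩
      ε ∎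
    where
    rearrange : ∀ a b c d → (a ℚ.+ b) ℚ.- (c ℚ.+ d) ≡ (a ℚ.- c) ℚ.+ (b ℚ.- d)
    rearrange = solve 4 (λ a b c d →
      (a :+ b) :- (c :+ d) := (a :- c) :+ (b :- d)) refl
      where open +-*-Solver

  bounded : ∀ {s} → IsCauchy s →
            ∃[ N ] ∃[ B ] 0ℚ ℚ.< B × (∀ n → N ℕ.≤ n → ℚ.∣ s n ∣ ℚ.≤ B)
  bounded {s} cs with N , p ← cs 1ℚ (ℚ.positive⁻¹ 1ℚ) =
    N , 1ℚ ℚ.+ ℚ.∣ s N ∣
      , ℚ.+-mono-<-≤ (ℚ.positive⁻¹ 1ℚ) (ℚ.0≤∣p∣ (s N))
      , λ n n≥ → let open ℚ.≤-Reasoning in begin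
          ℚ.∣ s n ∣                       ≡⟨ cong ℚ.∣_∣ (split (s n) (s N)) ⟩
          ℚ.∣ (s n ℚ.- s N) ℚ.+ s N ∣     ≤⟨ ℚ.∣p+q∣≤∣p∣+∣q∣ (s n ℚ.- s N) (s N) ⟩
          ℚ.∣ s n ℚ.- s N ∣ ℚ.+ ℚ.∣ s N ∣ ≤⟨ ℚ.+-monoˡ-≤ ℚ.∣ s N ∣ (ℚ.<⇒≤ (p n N n≥ ℕ.≤-refl)) ⟩
          1ℚ ℚ.+ ℚ.∣ s N ∣                ∎
    where
    split : ∀ a b → a ≡ (a ℚ.- b) ℚ.+ b
    split = solve 2 (λ a b → a := (a :- b) :+ b) refl
      where open +-*-Solver

  divide : ∀ C ε → 0ℚ ℚ.< C → 0ℚ ℚ.< ε → ∃[ δ ] 0ℚ ℚ.< δ × C ℚ.* δ ≡ ε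
  divide C ε 0<C 0<ε =
    ℚ.1/ C ℚ.* ε
    , subst (ℚ._< ℚ.1/ C ℚ.* ε) (ℚ.*-zeroʳ (ℚ.1/ C)) (ℚ.*-monoʳ-<-pos (ℚ.1/ C) 0<ε)
    , trans (sym (ℚ.*-assoc C (ℚ.1/ C) ε))
        (trans (cong (ℚ._* ε) (ℚ.*-inverseʳ C)) (ℚ.*-identityˡ ε))
    where
    instance
      C-pos : ℚ.Positive C
      C-pos = ℚ.positive 0<C

      C-nonZero : ℚ.NonZero C
      C-nonZero = ℚ.pos⇒nonZero C

      1/C-pos : ℚ.Positive (ℚ.1/ C)
      1/C-pos = ℚ.1/pos⇒pos C

  ∣a*b∣<C*δ : ∀ {C δ} a b → 0ℚ ℚ.< C → ℚ.∣ a ∣ ℚ.≤ C → ℚ.∣ b ∣ ℚ.< δ →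
              ℚ.∣ a ℚ.* b ∣ ℚ.< C ℚ.* δ
  ∣a*b∣<C*δ {C} {δ} a b 0<C a≤C b<δ = let open ℚ.≤-Reasoning in begin-strict
    ℚ.∣ a ℚ.* b ∣         ≡⟨ ℚ.∣p*q∣≡∣p∣*∣q∣ a b ⟩
    ℚ.∣ a ∣ ℚ.* ℚ.∣ b ∣   ≤⟨ ℚ.*-monoʳ-≤-nonNeg ℚ.∣ b ∣ {{ℚ.nonNegative (ℚ.0≤∣p∣ b)}} a≤C ⟩
    C ℚ.* ℚ.∣ b ∣         <⟨ ℚ.*-monoʳ-<-pos C {{ℚ.positive 0<C}} b<δ ⟩
    C ℚ.* δ               ∎

  *-cauchy-bounded : ∀ {s t} C K → 0ℚ ℚ.< C →
    (∀ n → K ℕ.≤ n → ℚ.∣ s n ∣ ℚ.≤ C) → (∀ n → K ℕ.≤ n → ℚ.∣ t n ∣ ℚ.≤ C) →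
    IsCauchy s → IsCauchy t → IsCauchy (λ n → s n ℚ.* t n)
  *-cauchy-bounded {s} {t} C K 0<C s≤C t≤C cs ct ε 0<ε
    with δ , 0<δ , Cδ ← divide C (½ ℚ.* ε) 0<C (half-pos 0<ε)
    with M , p ← cs δ 0<δ | N , q ← ct δ 0<δ =
      K ⊔ (M ⊔ N) , λ m n m≥ n≥ →
      let m≥K = ℕ.m⊔n≤o⇒m≤o K (M ⊔ N) m≥
          n≥K = ℕ.m⊔n≤o⇒m≤o K (M ⊔ N) n≥
          m≥′ = ℕ.m⊔n≤o⇒n≤o K (M ⊔ N) m≥
          n≥′ = ℕ.m⊔n≤o⇒n≤o K (M ⊔ N) n≥
          open ℚ.≤-Reasoning
      in begin-strict
        ℚ.∣ s m ℚ.* t m ℚ.- s n ℚ.* t n ∣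
          ≡⟨ cong ℚ.∣_∣ (rearrange (s m) (t m) (s n) (t n)) ⟩
        ℚ.∣ s m ℚ.* (t m ℚ.- t n) ℚ.+ t n ℚ.* (s m ℚ.- s n) ∣
          ≤⟨ ℚ.∣p+q∣≤∣p∣+∣q∣ (s m ℚ.* (t m ℚ.- t n)) (t n ℚ.* (s m ℚ.- s n)) ⟩
        ℚ.∣ s m ℚ.* (t m ℚ.- t n) ∣ ℚ.+ ℚ.∣ t n ℚ.* (s m ℚ.- s n) ∣
          <⟨ ℚ.+-mono-<
               (∣a*b∣<C*δ (s m) (t m ℚ.- t n) 0<C (s≤C m m≥K)
                 (q m n (ℕ.m⊔n≤o⇒n≤o M N m≥′) (ℕ.m⊔n≤o⇒n≤o M N n≥′)))
               (∣a*b∣<C*δ (t n) (s m ℚ.- s n) 0<C (t≤C n n≥K)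
                 (p m n (ℕ.m⊔n≤o⇒m≤o M N m≥′) (ℕ.m⊔n≤o⇒m≤o M N n≥′))) ⟩
        C ℚ.* δ ℚ.+ C ℚ.* δ
          ≡⟨ cong (λ z → z ℚ.+ z) Cδ ⟩
        ½ ℚ.* ε ℚ.+ ½ ℚ.* ε
          ≡⟨ halves ε ⟩
        ε ∎
    where
    rearrange : ∀ a b c d →
      a ℚ.* b ℚ.- c ℚ.* d ≡ a ℚ.* (b ℚ.- d) ℚ.+ d ℚ.* (a ℚ.- c)
    rearrange = solve 4 (λ a b c d →
      a :* b :- c :* d := a :* (b :- d) :+ d :* (a :- c)) refl
      where open +-*-Solver

  0<p+q : ∀ p q → 0ℚ ℚ.< p → 0ℚ ℚ.< q → 0ℚ ℚ.< p ℚ.+ q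
  0<p+q p q 0<p 0<q = ℚ.+-mono-< {0ℚ} {p} {0ℚ} {q} 0<p 0<q

  p≤p+q : ∀ p q → 0ℚ ℚ.< q → p ℚ.≤ p ℚ.+ q
  p≤p+q p q 0<q = subst (ℚ._≤ p ℚ.+ q) (ℚ.+-identityʳ p)
    (ℚ.+-monoʳ-≤ p {0ℚ} {q} (ℚ.<⇒≤ 0<q))

  q≤p+q : ∀ p q → 0ℚ ℚ.< p → q ℚ.≤ p ℚ.+ q
  q≤p+q p q 0<p = subst (ℚ._≤ p ℚ.+ q) (ℚ.+-identityˡ q)
    (ℚ.+-monoˡ-≤ q {0ℚ} {p} (ℚ.<⇒≤ 0<p))

  *-cauchy : ∀ {s t} → IsCauchy s → IsCauchy t → IsCauchy (λ n → s n ℚ.* t n)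
  *-cauchy {s} {t} cs ct = go (bounded {s} cs) (bounded {t} ct)
    where
    go : ∃[ N ] ∃[ B ] 0ℚ ℚ.< B × (∀ n → N ℕ.≤ n → ℚ.∣ s n ∣ ℚ.≤ B) →
         ∃[ N ] ∃[ B ] 0ℚ ℚ.< B × (∀ n → N ℕ.≤ n → ℚ.∣ t n ∣ ℚ.≤ B) →
         IsCauchy (λ n → s n ℚ.* t n)
    go (K , A , 0<A , s≤A) (L , B , 0<B , t≤B) =
      *-cauchy-bounded {s} {t} (A ℚ.+ B) (K ⊔ L) (0<p+q A B 0<A 0<B)
        (λ n n≥ → ℚ.≤-trans (s≤A n (ℕ.m⊔n≤o⇒m≤o K L n≥)) (p≤p+q A B 0<B))
        (λ n n≥ → ℚ.≤-trans (t≤B n (ℕ.m⊔n≤o⇒n≤o K L n≥)) (q≤p+q A B 0<A))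
        cs ct

infix  4 _≈_ _<_ _≤_ _#_
infixl 6 _+_
infixl 7 _*_

fromℚ : ℚ → ℝ
fromℚ q = mkℝ (λ _ → q) λ ε 0<ε → 0 , λ _ _ _ _ →
  subst (ℚ._< ε) (sym (∣p-p∣≡0 q)) 0<ε

_+_ : ℝ → ℝ → ℝ
x + y = mkℝ (λ n → seq x n ℚ.+ seq y n) (+-cauchy {seq x} {seq y} (cauchy x) (cauchy y))

_*_ : ℝ → ℝ → ℝ
x * y = mkℝ (λ n → seq x n ℚ.* seq y n) (*-cauchy {seq x} {seq y} (cauchy x) (cauchy y))

0ℝ 1ℝ 2ℝ -2ℝ : ℝ
0ℝ  = fromℚ 0ℚ
1ℝ  = fromℚ 1ℚ
2ℝ  = fromℚ (+ 2 ℚ./ 1)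
-2ℝ = fromℚ (-[1+ 1 ] ℚ./ 1)

_≈_ : Rel ℝ 0ℓ
x ≈ y = ∀ ε → 0ℚ ℚ.< ε →
  ∃[ N ] ∀ n → N ℕ.≤ n → ℚ.∣ seq x n ℚ.- seq y n ∣ ℚ.< ε

_<_ : Rel ℝ 0ℓ
x < y = ∃[ ε ] 0ℚ ℚ.< ε × ∃[ N ] ∀ n → N ℕ.≤ n → seq x n ℚ.+ ε ℚ.≤ seq y n

-- Constructively equivalent to: for every ε > 0, eventually x n < y n + ε.
_≤_ : Rel ℝ 0ℓ
x ≤ y = ¬ y < x

-- Apartness, the positive form of x ≠ y.
_#_ : Rel ℝ 0ℓ
x # y = x < y ⊎ y < x

+-0-rawMonoid : RawMonoid 0ℓ 0ℓ
+-0-rawMonoid = record { Carrier = ℝ ; _≈_ = _≈_ ; _∙_ = _+_ ; ε = 0ℝ }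

open Monoid +-0-rawMonoid public using (sum)

Matrix : ℕ → Set
Matrix n = Fin n → Fin n → ℝ

infixr 7 _*ᵥ_

_*ᵥ_ : ∀ {n} → Matrix n → Vector ℝ n → Vector ℝ n
(A *ᵥ x) i = sum (λ j → A i j * x j)

Eigenvector : ∀ {n} → Matrix n → ℝ → Vector ℝ n → Set
Eigenvector A λ′ x = (∃[ i ] x i # 0ℝ) × (∀ i → (A *ᵥ x) i ≈ λ′ * x i)

Eigenvalue : ∀ {n} → Matrix n → ℝ → Set
Eigenvalue A λ′ = ∃[ x ] Eigenvector A λ′ x

-- Multiplicity one, i.e. a one-dimensional eigenspace. For the symmetric
-- matrices below, geometric and algebraic multiplicities coincide.
SimpleEigenvalue : ∀ {n} → Matrix n → ℝ → Set
SimpleEigenvalue A λ′ = ∃[ x ] Eigenvector A λ′ x ×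
  (∀ y → Eigenvector A λ′ y → ∃[ c ] ∀ i → y i ≈ c * x i)

record Graph (V : Set) : Set₁ where
  infix 4 _~_ _~?_
  field
    _~_      : Rel V 0ℓ
    _~?_     : Decidable _~_
    ~-sym    : Symmetric _~_
    ~-irrefl : Irreflexive _≡_ _~_

infix 4 _≅_

_≅_ : ∀ {V W} → Graph V → Graph W → Set
_≅_ {V} {W} G H = Σ (V ↔ W) λ f →
  ∀ u v → (u G.~ v) ⇔ (Inverse.to f u H.~ Inverse.to f v)
  where
  module G = Graph G
  module H = Graph H

Bipartite : ∀ {V} → Graph V → Set
Bipartite {V} G = Σ (V → Bool) λ c → ∀ u v → u ~ v → c u ≢ c v
  where open Graph G

-- The subgraph induced on the vertices other than v, relabelled by the
-- order embedding punchIn v, whose image is exactly {u | u ≢ v}.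
infixl 6 _∖_

_∖_ : ∀ {n} → Graph (Fin (suc n)) → Fin (suc n) → Graph (Fin n)
G ∖ v = record
  { _~_      = λ i j → punchIn v i ~ punchIn v j
  ; _~?_     = λ i j → punchIn v i ~? punchIn v j
  ; ~-sym    = ~-sym
  ; ~-irrefl = λ i≡j → ~-irrefl (cong (punchIn v) i≡j)
  }
  where open Graph G

-- An edge is listed once, with its endpoints in increasing order; the
-- irrelevant fields make edges equal as soon as their endpoints are.
record Edge {m} (H : Graph (Fin m)) : Set where
  constructor edge
  field
    lo hi     : Fin m
    .lo<hi    : lo Fin.< hi
    .adjacent : Graph._~_ H lo hi

module _ {m} {H : Graph (Fin m)} where

  infix 4 _∈ₑ_

  _∈ₑ_ : Fin m → Edge H → Set
  w ∈ₑ e = w ≡ Edge.lo e ⊎ w ≡ Edge.hi e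

  ShareVertex : Rel (Edge H) 0ℓ
  ShareVertex e f = ∃[ w ] w ∈ₑ e × w ∈ₑ f

  infix 4 _≟ₑ_

  _≟ₑ_ : DecidableEquality (Edge H)
  edge a b _ _ ≟ₑ edge c d _ _ =
    map′ (λ { (refl , refl) → refl }) (λ { refl → refl , refl })
         ((a ≟ᶠ c) ×-dec (b ≟ᶠ d))

  shareVertex? : Decidable ShareVertex
  shareVertex? e f = any? λ w →
    ((w ≟ᶠ Edge.lo e) ⊎-dec (w ≟ᶠ Edge.hi e)) ×-dec
    ((w ≟ᶠ Edge.lo f) ⊎-dec (w ≟ᶠ Edge.hi f))

L : ∀ {m} (H : Graph (Fin m)) → Graph (Edge H)
L H = record
  { _~_      = λ e f → e ≢ f × ShareVertex e f
  ; _~?_     = λ e f → ¬? (e ≟ₑ f) ×-dec shareVertex? e f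
  ; ~-sym    = λ { (e≢f , w , w∈e , w∈f) → e≢f ∘ sym , w , w∈f , w∈e }
  ; ~-irrefl = λ { e≡f (e≢f , _) → e≢f e≡f }
  }

IsLineGraph : ∀ {V} → Graph V → Set₁
IsLineGraph G = ∃[ m ] Σ (Graph (Fin m)) λ H → G ≅ L H

adjacencyMatrix : ∀ {n} → Graph (Fin n) → Matrix n
adjacencyMatrix G i j = if does (i ~? j) then 1ℝ else 0ℝ
  where open Graph G

-- The adjacency matrix is symmetric, so its eigenvalues are all real.
Cyclotomic : ∀ {n} → Graph (Fin n) → Set
Cyclotomic G = ∀ μ → Eigenvalue (adjacencyMatrix G) μ → -2ℝ ≤ μ × μ ≤ 2ℝ

-- Eigenvalues are counted with multiplicity, so the one above 2 is simple.
Salem : ∀ {n} → Graph (Fin n) → Set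
Salem G =
  ¬ Bipartite G ×
  (∃[ λ′ ] 2ℝ < λ′ × SimpleEigenvalue A λ′ ×
    (∀ μ → 2ℝ < μ → Eigenvalue A μ → μ ≈ λ′)) ×
  (∀ μ → Eigenvalue A μ → ¬ μ < -2ℝ)
  where A = adjacencyMatrix G

{-# OPTIONS --safe #-}

-- If 2I - A were positive semidefinite then G would be cyclotomic, because A + 2I is a Gram matrix. So some
-- rational vector has Rayleigh quotient above 2, while 2I - A is positive semidefinite on vectors vanishing
-- at v. Semidefiniteness of a rational symmetric matrix is decidable, so the top eigenvalue of A is found by
-- bisection. For a parameter q bounded away from 2 from above, the vector with v-coordinate 1 that solves the
-- eigenvector equation off v depends uniformly continuously on q and converges to an eigenvector. Two
-- eigenvectors for eigenvalues above 2 combine to a vector vanishing at v, which gives simplicity and uniqueness.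
-- That cyclotomicity of G ∖ v bounds its quadratic form by 2 is a negative statement: there it suffices
-- that a top eigenvector cannot fail to exist, which allows a case distinction on a spectral gap.
module Submission where

open import Defs hiding (_+_; _*_; _<_; _≤_; sum)
import Defs as ℝ
open import Data.Bool.Base using (true; false; if_then_else_)
open import Data.Nat.Base as ℕ using (ℕ; zero; suc)
import Data.Nat.Properties as ℕ
open import Data.Fin.Base as Fin using (Fin; zero; suc; punchIn; punchOut)
open import Data.Fin.Properties as Fin using (punchIn-punchOut)
open import Data.Integer.Base as ℤ using (-[1+_])
import Data.Integer.Properties as ℤ
open import Data.Product.Base using (∃-syntax; _×_; _,_; proj₁; proj₂)
open import Data.Rational.Base using (ℚ; 0ℚ; 1ℚ; ½; _+_; _*_; _-_; -_; _≤_; _<_; ∣_∣)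
import Data.Rational.Base as ℚ
import Data.Rational.Properties as ℚ
import Data.Rational.Unnormalised.Base as ℚᵘ
import Data.Rational.Unnormalised.Properties as ℚᵘ
open import Data.Rational.Solver using (module +-*-Solver)
open import Data.Sum.Base using (_⊎_; inj₁; inj₂; [_,_]′)
open import Data.Vec.Functional using (Vector; insertAt)
open import Data.Vec.Functional.Properties using (insertAt-lookup; insertAt-punchIn)
open import Function.Base using (_∘_)
open import Function.Bundles using (Equivalence; Inverse)
open import Relation.Binary.Definitions using (Tri; tri<; tri≈; tri>)
open import Relation.Binary.PropositionalEquality
  using (_≡_; _≢_; refl; sym; trans; cong; cong₂; subst; subst₂; module ≡-Reasoning)
open import Relation.Nullary using (¬_; Dec; yes; no; does; contradiction)
open import Algebra.Bundles using (CommutativeRing)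
open import Algebra.Properties.Semiring.Sum (CommutativeRing.semiring ℚ.+-*-commutativeRing)
  using (sum; sum-cong-≗; sum-remove; sum-replicate-zero; ∑-distrib-+; ∑-comm; *-distribˡ-sum)
open import Relation.Nullary.Decidable using (dec-true; dec-false; recompute)

open +-*-Solver using (solve; con; _:=_; _:+_; _:*_; _:-_; :-_)

-- Two obstacles shape the proof: equality of reals is undecidable, and compactness of the sphere
-- yields no maximiser of the Rayleigh quotient constructively, while a Salem graph must come with
-- an actual eigenvector. All estimates are therefore made on rational vectors, and real
-- eigenvectors are seen only through rational approximations whose residuals tend to zero. Fixing
-- the v-coordinate at 1 is what makes the limit explicit: a vector vanishing at v has Rayleigh
-- quotient at most 2, so a top eigenvector cannot vanish there, and the remaining coordinates solve
-- a linear system that is positive definite with a known constant. After the deletion of v no such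
-- coordinate is known, because the top eigenvalue may be shared with smaller principal minors and a
-- gap between them cannot be decided. The double negation does no harm, since the resulting bound
-- on a rational form is decidable.

private variable
  n : ℕ
  p q r : ℚ

-- Ordered field arithmetic

-- Inequalities are proved by certificates: `d` is assembled from visibly nonnegative terms, and
-- what remains is a ring identity for the solver.
≤-by : ∀ {d} → 0ℚ ≤ d → q ≡ p + d → p ≤ q
≤-by {q} {p} {d} 0≤d q≡p+d = subst₂ _≤_ (ℚ.+-identityʳ p) (sym q≡p+d) (ℚ.+-monoʳ-≤ p 0≤d)

<-by : ∀ {d} → 0ℚ < d → q ≡ p + d → p < q
<-by {q} {p} {d} 0<d q≡p+d = subst₂ _<_ (ℚ.+-identityʳ p) (sym q≡p+d) (ℚ.+-monoʳ-< p 0<d)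

p≤q⇒0≤q-p : p ≤ q → 0ℚ ≤ q - p
p≤q⇒0≤q-p {p} {q} p≤q = subst (_≤ q - p) (ℚ.+-inverseʳ p) (ℚ.+-monoˡ-≤ (- p) p≤q)

p<q⇒0<q-p : p < q → 0ℚ < q - p
p<q⇒0<q-p {p} {q} p<q = subst (_< q - p) (ℚ.+-inverseʳ p) (ℚ.+-monoˡ-< (- p) p<q)

0≤-+ : 0ℚ ≤ p → 0ℚ ≤ q → 0ℚ ≤ p + q
0≤-+ 0≤p 0≤q = ℚ.+-mono-≤ 0≤p 0≤q

0<-+ : 0ℚ < p → 0ℚ < q → 0ℚ < p + q
0<-+ 0<p 0<q = ℚ.+-mono-< 0<p 0<q

0<-+ʳ : 0ℚ < p → 0ℚ ≤ q → 0ℚ < p + q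
0<-+ʳ 0<p 0≤q = ℚ.+-mono-<-≤ 0<p 0≤q

*-monoˡ-≤ : 0ℚ ≤ r → p ≤ q → r * p ≤ r * q
*-monoˡ-≤ {r} 0≤r = ℚ.*-monoˡ-≤-nonNeg r {{ℚ.nonNegative 0≤r}}

*-monoˡ-< : 0ℚ < r → p < q → r * p < r * q
*-monoˡ-< {r} 0<r = ℚ.*-monoʳ-<-pos r {{ℚ.positive 0<r}}

*-cancelˡ-≤ : 0ℚ < r → r * p ≤ r * q → p ≤ q
*-cancelˡ-≤ {r} 0<r = ℚ.*-cancelˡ-≤-pos r {{ℚ.positive 0<r}}

0≤-* : 0ℚ ≤ p → 0ℚ ≤ q → 0ℚ ≤ p * q
0≤-* {p} {q} 0≤p 0≤q = subst (_≤ p * q) (ℚ.*-zeroʳ p) (*-monoˡ-≤ 0≤p 0≤q)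

0<-* : 0ℚ < p → 0ℚ < q → 0ℚ < p * q
0<-* {p} {q} 0<p 0<q = subst (_< p * q) (ℚ.*-zeroʳ p) (*-monoˡ-< 0<p 0<q)

0≤p*p : ∀ p → 0ℚ ≤ p * p
0≤p*p p with ℚ.≤-total 0ℚ p
... | inj₁ 0≤p = 0≤-* 0≤p 0≤p
... | inj₂ p≤0 = subst (0ℚ ≤_) (solve 1 (λ p → (:- p) :* (:- p) := p :* p) refl p) (0≤-* 0≤-p 0≤-p)
  where
  0≤-p : 0ℚ ≤ - p
  0≤-p = ℚ.neg-antimono-≤ p≤0

0<p*p : p ≢ 0ℚ → 0ℚ < p * p
0<p*p {p} p≢0 with ℚ.<-cmp 0ℚ p
... | tri< 0<p _ _ = 0<-* 0<p 0<p
... | tri≈ _ 0≡p _ = contradiction (sym 0≡p) p≢0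
... | tri> _ _ p<0 = subst (0ℚ <_) (solve 1 (λ p → (:- p) :* (:- p) := p :* p) refl p) (0<-* 0<-p 0<-p)
  where
  0<-p : 0ℚ < - p
  0<-p = ℚ.neg-antimono-< p<0

0<½ : 0ℚ < ½
0<½ = ℚ.positive⁻¹ ½

0<1 : 0ℚ < 1ℚ
0<1 = ℚ.positive⁻¹ 1ℚ

2ℚ : ℚ
2ℚ = ℤ.+ 2 ℚ./ 1

0<2 : 0ℚ < 2ℚ
0<2 = ℚ.positive⁻¹ 2ℚ

reciprocal : 0ℚ < p → ∃[ d ] 0ℚ < d × p * d ≡ 1ℚ
reciprocal {p} 0<p = ℚ.1/ p , ℚ.positive⁻¹ (ℚ.1/ p) , ℚ.*-inverseʳ p
  where
  instance
    p-pos : ℚ.Positive p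
    p-pos = ℚ.positive 0<p

    p-nonZero : ℚ.NonZero p
    p-nonZero = ℚ.pos⇒nonZero p

    1/p-pos : ℚ.Positive (ℚ.1/ p)
    1/p-pos = ℚ.1/pos⇒pos p

p≤∣p∣ : ∀ p → p ≤ ∣ p ∣
p≤∣p∣ p with ℚ.≤-total 0ℚ p
... | inj₁ 0≤p = ℚ.≤-reflexive (sym (ℚ.0≤p⇒∣p∣≡p 0≤p))
... | inj₂ p≤0 = ℚ.≤-trans p≤0 (ℚ.0≤∣p∣ p)

-p≤∣p∣ : ∀ p → - p ≤ ∣ p ∣
-p≤∣p∣ p = subst (- p ≤_) (ℚ.∣-p∣≡∣p∣ p) (p≤∣p∣ (- p))

∣p∣≤ : p ≤ q → - p ≤ q → ∣ p ∣ ≤ q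
∣p∣≤ {p} p≤q -p≤q with ℚ.∣p∣≡p∨∣p∣≡-p p
... | inj₁ eq = subst (_≤ _) (sym eq) p≤q
... | inj₂ eq = subst (_≤ _) (sym eq) -p≤q

∣p∣*∣p∣≡p*p : ∀ p → ∣ p ∣ * ∣ p ∣ ≡ p * p
∣p∣*∣p∣≡p*p p = trans (sym (ℚ.∣p*q∣≡∣p∣*∣q∣ p p)) (ℚ.0≤p⇒∣p∣≡p (0≤p*p p))

≤⇒≯ : p ≤ q → ¬ q < p
≤⇒≯ p≤q q<p = ℚ.<-irrefl refl (ℚ.<-≤-trans q<p p≤q)

square-cancel-< : 0ℚ < r → p * p < r * r → ∣ p ∣ < r
square-cancel-< {r} {p} 0<r p²<r² with ∣ p ∣ ℚ.<? r
... | yes ∣p∣<r = ∣p∣<r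
... | no ∣p∣≮r = contradiction p²<r² (≤⇒≯ (ℚ.≤-trans (*-monoˡ-≤ (ℚ.<⇒≤ 0<r) r≤∣p∣)
    (subst₂ _≤_ (ℚ.*-comm ∣ p ∣ r) (∣p∣*∣p∣≡p*p p) (*-monoˡ-≤ (ℚ.0≤∣p∣ p) r≤∣p∣))))
  where
  r≤∣p∣ : r ≤ ∣ p ∣
  r≤∣p∣ = ℚ.≮⇒≥ ∣p∣≮r

fromℕ : ℕ → ℚ
fromℕ zero    = 0ℚ
fromℕ (suc k) = 1ℚ + fromℕ k

toℚᵘ-fromℕ : ∀ k → ℚ.toℚᵘ (fromℕ k) ℚᵘ.≃ ℚᵘ.mkℚᵘ (ℤ.+ k) 0
toℚᵘ-fromℕ zero    = ℚᵘ.≃-refl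
toℚᵘ-fromℕ (suc k) = ℚᵘ.≃-trans (ℚ.toℚᵘ-homo-+ 1ℚ (fromℕ k))
  (ℚᵘ.≃-trans (ℚᵘ.+-congʳ ℚᵘ.1ℚᵘ (toℚᵘ-fromℕ k)) (ℚᵘ.*≡* (cong (ℤ._* (ℤ.+ 1)) (cong ℤ.suc (ℤ.*-identityʳ (ℤ.+ k))))))

-- The numerator serves as the bound, the denominator being at least 1; a negative rational lies
-- below 0.
archimedean : ∀ p → ∃[ k ] p ≤ fromℕ k
archimedean (ℚ.mkℚ (ℤ.+ i) d c) = i , ℚ.toℚᵘ-cancel-≤
  (ℚᵘ.≤-respʳ-≃ (ℚᵘ.≃-sym (toℚᵘ-fromℕ i)) (ℚᵘ.*≤* (ℤ.*-monoˡ-≤-nonNeg (ℤ.+ i) (ℤ.+≤+ (ℕ.s≤s ℕ.z≤n)))))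
archimedean p@(ℚ.mkℚ -[1+ i ] d c) = 0 , ℚ.<⇒≤ (ℚ.negative⁻¹ p)

2^_ : ℕ → ℚ
2^ zero  = 1ℚ
2^ suc k = 2^ k + 2^ k

1≤2^ : ∀ k → 1ℚ ≤ 2^ k
1≤2^ zero    = ℚ.≤-refl
1≤2^ (suc k) = ℚ.≤-trans (1≤2^ k) (≤-by (ℚ.≤-trans (ℚ.<⇒≤ 0<1) (1≤2^ k)) refl)

fromℕ<2^ : ∀ k → fromℕ k < 2^ k
fromℕ<2^ zero    = 0<1
fromℕ<2^ (suc k) = ℚ.+-mono-≤-< (1≤2^ k) (fromℕ<2^ k)

monotone : ∀ {f : ℕ → ℚ} → (∀ k → f k ≤ f (suc k)) → ∀ {j k} → j ℕ.≤ k → f j ≤ f k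
monotone {f} step j≤k = go (ℕ.≤⇒≤′ j≤k)
  where
  go : ∀ {j k} → j ℕ.≤′ k → f j ≤ f k
  go (ℕ.≤′-reflexive refl) = ℚ.≤-refl
  go (ℕ.≤′-step j≤k)       = ℚ.≤-trans (go j≤k) (step _)

-- Rational vectors and quadratic forms

ℚMatrix : ℕ → Set
ℚMatrix n = Fin n → Fin n → ℚ

infixl 7 _·_
infixr 8 _⊛_
infixl 6 _+[_]_

_·_ : Vector ℚ n → Vector ℚ n → ℚ
x · y = sum (λ i → x i * y i)

_⊛_ : ∀ {m} → (Fin m → Vector ℚ n) → Vector ℚ n → Vector ℚ m
(M ⊛ x) i = M i · x

_+[_]_ : Vector ℚ n → ℚ → Vector ℚ n → Vector ℚ n
(x +[ c ] y) i = x i + c * y i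

quad : ℚMatrix n → Vector ℚ n → ℚ
quad M x = x · M ⊛ x

IsSymmetric : ℚMatrix n → Set
IsSymmetric M = ∀ i j → M i j ≡ M j i

PositiveSemidefinite : ℚMatrix n → Set
PositiveSemidefinite M = ∀ x → 0ℚ ≤ quad M x

·-comm : ∀ (x y : Vector ℚ n) → x · y ≡ y · x
·-comm x y = sum-cong-≗ (λ i → ℚ.*-comm (x i) (y i))

·-congʳ : ∀ (x : Vector ℚ n) {y z} → (∀ i → y i ≡ z i) → x · y ≡ x · z
·-congʳ x y≗z = sum-cong-≗ (λ i → cong (x i *_) (y≗z i))

·-zeroʳ : ∀ (x : Vector ℚ n) {y} → (∀ i → y i ≡ 0ℚ) → x · y ≡ 0ℚ
·-zeroʳ {n} x y≗0 = trans (sum-cong-≗ (λ i → trans (cong (x i *_) (y≗0 i)) (ℚ.*-zeroʳ (x i)))) (sum-replicate-zero n)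

·-combʳ : ∀ (x y : Vector ℚ n) c z → x · (y +[ c ] z) ≡ x · y + c * (x · z)
·-combʳ x y c z = begin
  x · (y +[ c ] z)
    ≡⟨ sum-cong-≗ (λ i → solve 4 (λ x y c z → x :* (y :+ c :* z) := x :* y :+ c :* (x :* z)) refl (x i) (y i) c (z i)) ⟩
  sum (λ i → x i * y i + c * (x i * z i))
    ≡⟨ ∑-distrib-+ (λ i → x i * y i) (λ i → c * (x i * z i)) ⟩
  x · y + sum (λ i → c * (x i * z i))
    ≡⟨ cong ((x · y) +_) (*-distribˡ-sum c (λ i → x i * z i)) ⟨
  x · y + c * (x · z) ∎
  where open ≡-Reasoning

·-combˡ : ∀ (x : Vector ℚ n) c y z → (x +[ c ] y) · z ≡ x · z + c * (y · z)
·-combˡ x c y z = trans (·-comm (x +[ c ] y) z)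
  (trans (·-combʳ z x c y) (cong₂ (λ a b → a + c * b) (·-comm z x) (·-comm z y)))

0≤x·x : ∀ (x : Vector ℚ n) → 0ℚ ≤ x · x
0≤x·x {zero}  x = ℚ.≤-refl
0≤x·x {suc n} x = 0≤-+ (0≤p*p (x zero)) (0≤x·x (x ∘ suc))

xᵢ*xᵢ≤x·x : ∀ (x : Vector ℚ n) i → x i * x i ≤ x · x
xᵢ*xᵢ≤x·x x zero    = ≤-by (0≤x·x (x ∘ suc)) refl
xᵢ*xᵢ≤x·x x (suc i) = ℚ.≤-trans (xᵢ*xᵢ≤x·x (x ∘ suc) i) (≤-by (0≤p*p (x zero)) (ℚ.+-comm (x zero * x zero) _))

·-splitAt : ∀ v (x y : Vector ℚ (suc n)) → x · y ≡ x v * y v + (x ∘ punchIn v) · (y ∘ punchIn v)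
·-splitAt v x y = sum-remove {i = v} (λ i → x i * y i)

·-⊛-adjoint : ∀ {m} (N : Fin m → Vector ℚ n) x y → x · N ⊛ y ≡ y · (λ j i → N i j) ⊛ x
·-⊛-adjoint N x y = begin
  sum (λ i → x i * sum (λ j → N i j * y j))
    ≡⟨ sum-cong-≗ (λ i → *-distribˡ-sum (x i) (λ j → N i j * y j)) ⟩
  sum (λ i → sum (λ j → x i * (N i j * y j)))
    ≡⟨ ∑-comm (λ i j → x i * (N i j * y j)) ⟩
  sum (λ j → sum (λ i → x i * (N i j * y j)))
    ≡⟨ sum-cong-≗ (λ j → sum-cong-≗ (λ i →
         solve 3 (λ x m y → x :* (m :* y) := y :* (m :* x)) refl (x i) (N i j) (y j))) ⟩
  sum (λ j → sum (λ i → y j * (N i j * x i)))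
    ≡⟨ sum-cong-≗ (λ j → *-distribˡ-sum (y j) (λ i → N i j * x i)) ⟨
  sum (λ j → y j * sum (λ i → N i j * x i)) ∎
  where open ≡-Reasoning

·-⊛-sym : ∀ {M : ℚMatrix n} → IsSymmetric M → ∀ x y → x · M ⊛ y ≡ y · M ⊛ x
·-⊛-sym {M = M} M-sym x y = trans (·-⊛-adjoint M x y)
  (·-congʳ y (λ j → sum-cong-≗ (λ i → cong (_* x i) (M-sym i j))))

-- The form at `x` is the squared length of `b`, the combination of the rows of `N` with
-- coefficients `x`.
gram-positiveSemidefinite : ∀ {m} (N : Fin n → Vector ℚ m) {M : ℚMatrix n} → (∀ i j → M i j ≡ N i · N j) → PositiveSemidefinite M
gram-positiveSemidefinite {n = n} {m = m} N {M} M≡NNᵀ x = subst (0ℚ ≤_) (sym quad≡) (0≤x·x b)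
  where
  open ≡-Reasoning
  b : Vector ℚ m
  b = (λ j i → N i j) ⊛ x
  row : ∀ i → (M ⊛ x) i ≡ (N ⊛ b) i
  row i = begin
    M i · x              ≡⟨ ·-comm (M i) x ⟩
    x · M i              ≡⟨ ·-congʳ x (λ j → trans (M≡NNᵀ i j) (·-comm (N i) (N j))) ⟩
    x · N ⊛ N i          ≡⟨ ·-⊛-adjoint N x (N i) ⟩
    N i · b              ∎
  quad≡ : quad M x ≡ b · b
  quad≡ = trans (·-congʳ x row) (·-⊛-adjoint N x b)

quad-comb : ∀ {M : ℚMatrix n} → IsSymmetric M → ∀ x c y →
            quad M (x +[ c ] y) ≡ quad M x + 2ℚ * c * (y · M ⊛ x) + c * c * quad M y
quad-comb {M = M} M-sym x c y = begin
  (x +[ c ] y) · M ⊛ (x +[ c ] y)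
    ≡⟨ ·-congʳ (x +[ c ] y) (λ i → ·-combʳ (M i) x c y) ⟩
  (x +[ c ] y) · (M ⊛ x +[ c ] M ⊛ y)
    ≡⟨ ·-combˡ x c y _ ⟩
  x · (M ⊛ x +[ c ] M ⊛ y) + c * (y · (M ⊛ x +[ c ] M ⊛ y))
    ≡⟨ cong₂ (λ a b → a + c * b) (·-combʳ x (M ⊛ x) c (M ⊛ y)) (·-combʳ y (M ⊛ x) c (M ⊛ y)) ⟩
  (quad M x + c * (x · M ⊛ y)) + c * (y · M ⊛ x + c * quad M y)
    ≡⟨ cong (λ b → (quad M x + c * b) + c * (y · M ⊛ x + c * quad M y)) (·-⊛-sym M-sym x y) ⟩
  (quad M x + c * (y · M ⊛ x)) + c * (y · M ⊛ x + c * quad M y)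
    ≡⟨ solve 4 (λ A B C c → (A :+ c :* B) :+ c :* (B :+ c :* C) := A :+ con 2ℚ :* c :* B :+ c :* c :* C)
         refl (quad M x) (y · M ⊛ x) (quad M y) c ⟩
  quad M x + 2ℚ * c * (y · M ⊛ x) + c * c * quad M y ∎
  where open ≡-Reasoning

δ : Fin n → Vector ℚ n
δ i j = if does (i Fin.≟ j) then 1ℚ else 0ℚ

δ-· : ∀ i (x : Vector ℚ n) → δ i · x ≡ x i
δ-· {suc n} zero x = trans (cong₂ _+_ (ℚ.*-identityˡ (x zero)) (trans (sum-cong-≗ (λ j → ℚ.*-zeroˡ (x (suc j)))) (sum-replicate-zero n)))
  (ℚ.+-identityʳ (x zero))
δ-· (suc i) x = trans (cong₂ _+_ (ℚ.*-zeroˡ (x zero)) (δ-· i (x ∘ suc))) (ℚ.+-identityˡ (x (suc i)))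

δᵢᵢ≡1 : ∀ (i : Fin n) → δ i i ≡ 1ℚ
δᵢᵢ≡1 zero    = refl
δᵢᵢ≡1 (suc i) = δᵢᵢ≡1 i

δ-sym : IsSymmetric {n} δ
δ-sym zero    zero    = refl
δ-sym zero    (suc j) = refl
δ-sym (suc i) zero    = refl
δ-sym (suc i) (suc j) = δ-sym i j

δ·⊛δ : ∀ (M : ℚMatrix n) i j → δ i · M ⊛ δ j ≡ M i j
δ·⊛δ M i j = trans (δ-· i (M ⊛ δ j)) (trans (·-comm (M i) (δ j)) (δ-· j (M i)))

δ-≢ : ∀ {i j : Fin n} → i ≢ j → δ i j ≡ 0ℚ
δ-≢ {i = i} {j} i≢j = cong (if_then 1ℚ else 0ℚ) (dec-false (i Fin.≟ j) i≢j)

minor : Fin (suc n) → ℚMatrix (suc n) → ℚMatrix n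
minor v M i j = M (punchIn v i) (punchIn v j)

quad-minor : ∀ v (M : ℚMatrix (suc n)) x → x v ≡ 0ℚ → quad M x ≡ quad (minor v M) (x ∘ punchIn v)
quad-minor v M x xᵥ≡0 = begin
  x · M ⊛ x
    ≡⟨ ·-splitAt v x (M ⊛ x) ⟩
  x v * (M ⊛ x) v + (x ∘ punchIn v) · ((M ⊛ x) ∘ punchIn v)
    ≡⟨ cong₂ _+_ (trans (cong (_* ((M ⊛ x) v)) xᵥ≡0) (ℚ.*-zeroˡ ((M ⊛ x) v))) (·-congʳ (x ∘ punchIn v) row) ⟩
  0ℚ + quad (minor v M) (x ∘ punchIn v)
    ≡⟨ ℚ.+-identityˡ _ ⟩
  quad (minor v M) (x ∘ punchIn v) ∎
  where
  open ≡-Reasoning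
  row : ∀ i → (M ⊛ x) (punchIn v i) ≡ (minor v M ⊛ (x ∘ punchIn v)) i
  row i = begin
    M (punchIn v i) · x
      ≡⟨ ·-splitAt v (M (punchIn v i)) x ⟩
    M (punchIn v i) v * x v + (minor v M ⊛ (x ∘ punchIn v)) i
      ≡⟨ cong (_+ (minor v M ⊛ (x ∘ punchIn v)) i) (trans (cong ((M (punchIn v i) v) *_) xᵥ≡0) (ℚ.*-zeroʳ (M (punchIn v i) v))) ⟩
    0ℚ + (minor v M ⊛ (x ∘ punchIn v)) i
      ≡⟨ ℚ.+-identityˡ _ ⟩
    (minor v M ⊛ (x ∘ punchIn v)) i ∎

·-minor : ∀ v (x : Vector ℚ (suc n)) → x v ≡ 0ℚ → x · x ≡ (x ∘ punchIn v) · (x ∘ punchIn v)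
·-minor v x xᵥ≡0 = trans (·-splitAt v x x) (trans (cong (_+ ((x ∘ punchIn v) · (x ∘ punchIn v))) (trans (cong (_* x v) xᵥ≡0) (ℚ.*-zeroˡ (x v)))) (ℚ.+-identityˡ _))

_∷_ : ℚ → Vector ℚ n → Vector ℚ (suc n)
(x₀ ∷ y) zero    = x₀
(x₀ ∷ y) (suc i) = y i

-- Schur complements, deciding semidefiniteness, definite linear systems

module Schur (M : ℚMatrix (suc n)) (M-sym : IsSymmetric M) where

  a : ℚ
  a = M zero zero

  b : Vector ℚ n
  b = M zero ∘ suc

  C : ℚMatrix n
  C = minor zero M

  quad-block : ∀ x → let y = x ∘ suc in quad M x ≡ a * x zero * x zero + 2ℚ * x zero * (b · y) + quad C y
  quad-block x = begin
    x zero * (a * x zero + b · y) + y · (λ i → M (suc i) · x)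
      ≡⟨ cong ((x zero * (a * x zero + b · y)) +_) (trans (·-congʳ y row) (·-combʳ y (C ⊛ y) (x zero) b)) ⟩
    x zero * (a * x zero + b · y) + (quad C y + x zero * (y · b))
      ≡⟨ cong (λ t → x zero * (a * x zero + b · y) + (quad C y + x zero * t)) (·-comm y b) ⟩
    x zero * (a * x zero + b · y) + (quad C y + x zero * (b · y))
      ≡⟨ solve 4 (λ a x B c → x :* (a :* x :+ B) :+ (c :+ x :* B) := a :* x :* x :+ con 2ℚ :* x :* B :+ c)
           refl a (x zero) (b · y) (quad C y) ⟩
    a * x zero * x zero + 2ℚ * x zero * (b · y) + quad C y ∎
    where
    open ≡-Reasoning
    y : Vector ℚ n
    y = x ∘ suc
    row : ∀ i → M (suc i) · x ≡ (C ⊛ y +[ x zero ] b) i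
    row i = begin
      M (suc i) zero * x zero + (C ⊛ y) i ≡⟨ cong (λ m → m * x zero + (C ⊛ y) i) (M-sym (suc i) zero) ⟩
      b i * x zero + (C ⊛ y) i            ≡⟨ solve 3 (λ b x c → b :* x :+ c := c :+ x :* b) refl (b i) (x zero) ((C ⊛ y) i) ⟩
      (C ⊛ y) i + x zero * b i            ∎

  module _ {d : ℚ} (a*d≡1 : a * d ≡ 1ℚ) where

    -- The Schur complement C - b bᵀ / a, with `d` in place of 1/a. Each row has the shape of
    -- `_+[_]_`, so that `·-combˡ` applies to it directly.
    complement : ℚMatrix n
    complement i j = C i j + (- (d * b i)) * b j

    complement-sym : IsSymmetric complement
    complement-sym i j = cong₂ _+_ (M-sym (suc i) (suc j))
      (solve 3 (λ d b c → (:- (d :* b)) :* c := (:- (d :* c)) :* b) refl d (b i) (b j))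

    complement-⊛ : ∀ y i → (complement ⊛ y) i ≡ (C ⊛ y) i + (- (d * (b · y))) * b i
    complement-⊛ y i = begin
      complement i · y                       ≡⟨ ·-combˡ (C i) (- (d * b i)) b y ⟩
      (C ⊛ y) i + (- (d * b i)) * (b · y)    ≡⟨ cong (((C ⊛ y) i) +_) (solve 3 (λ d b c → (:- (d :* b)) :* c := (:- (d :* c)) :* b) refl d (b i) (b · y)) ⟩
      (C ⊛ y) i + (- (d * (b · y))) * b i    ∎
      where open ≡-Reasoning

    quad-complement : ∀ y → quad complement y ≡ quad C y - d * (b · y) * (b · y)
    quad-complement y = begin
      y · complement ⊛ y                              ≡⟨ ·-congʳ y (complement-⊛ y) ⟩
      y · (C ⊛ y +[ - (d * (b · y)) ] b)              ≡⟨ ·-combʳ y (C ⊛ y) (- (d * (b · y))) b ⟩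
      quad C y + (- (d * (b · y))) * (y · b)          ≡⟨ cong (λ t → quad C y + (- (d * (b · y))) * t) (·-comm y b) ⟩
      quad C y + (- (d * (b · y))) * (b · y)          ≡⟨ solve 3 (λ c d t → c :+ (:- (d :* t)) :* t := c :- d :* t :* t) refl (quad C y) d (b · y) ⟩
      quad C y - d * (b · y) * (b · y)                ∎
      where open ≡-Reasoning

    -- Completing the square in the first coordinate.
    quad-square : ∀ x → let y = x ∘ suc; s = x zero + d * (b · y) in quad M x ≡ a * (s * s) + quad complement y
    quad-square x = begin
      quad M x
        ≡⟨ quad-block x ⟩
      a * x zero * x zero + 2ℚ * x zero * B + quad C y
        -- A factor 1 is inserted so that it can be replaced by `a * d`; then the square is
        -- completed by a ring identity.
        ≡⟨ solve 4 (λ a x B c → a :* x :* x :+ con 2ℚ :* x :* B :+ c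
                             := a :* x :* x :+ con 2ℚ :* con 1ℚ :* x :* B :+ c) refl a (x zero) B (quad C y) ⟩
      a * x zero * x zero + 2ℚ * 1ℚ * x zero * B + quad C y
        ≡⟨ cong (λ t → a * x zero * x zero + 2ℚ * t * x zero * B + quad C y) a*d≡1 ⟨
      a * x zero * x zero + 2ℚ * (a * d) * x zero * B + quad C y
        ≡⟨ solve 5 (λ a x B c d → a :* x :* x :+ con 2ℚ :* (a :* d) :* x :* B :+ c
                               := a :* ((x :+ d :* B) :* (x :+ d :* B)) :+ (c :- (a :* d) :* d :* B :* B))
             refl a (x zero) B (quad C y) d ⟩
      a * (s * s) + (quad C y - (a * d) * d * B * B)
        ≡⟨ cong (λ t → a * (s * s) + (quad C y - t * d * B * B)) a*d≡1 ⟩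
      a * (s * s) + (quad C y - 1ℚ * d * B * B)
        ≡⟨ cong (λ t → a * (s * s) + (quad C y - t * B * B)) (ℚ.*-identityˡ d) ⟩
      a * (s * s) + (quad C y - d * B * B)
        ≡⟨ cong ((a * (s * s)) +_) (quad-complement y) ⟨
      a * (s * s) + quad complement y ∎
      where
      open ≡-Reasoning
      y : Vector ℚ n
      y = x ∘ suc
      B s : ℚ
      B = b · y
      s = x zero + d * B

    -- The first coordinate is the one that makes the square in `quad-square` vanish; for positive
    -- `a` it minimises the form with the other coordinates held fixed.
    minimiser : Vector ℚ n → Vector ℚ (suc n)
    minimiser y = (- (d * (b · y))) ∷ y

    quad-minimiser : ∀ y → quad M (minimiser y) ≡ quad complement y
    quad-minimiser y = trans (quad-square (minimiser y))
      (solve 3 (λ a t c → a :* ((:- t :+ t) :* (:- t :+ t)) :+ c := c) refl a (d * (b · y)) (quad complement y))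

-- On the line from the j-th unit vector in the direction of the i-th one, the quadratic term
-- vanishes with `M i i`. The form is then affine with the nonzero slope 2 `M i j`, and `s` is the
-- parameter at which it equals -1.
indefinite : ∀ (M : ℚMatrix n) → IsSymmetric M → ∀ {i j} → M i i ≡ 0ℚ → M i j ≢ 0ℚ → ∃[ x ] quad M x < 0ℚ
indefinite M M-sym {i} {j} Mᵢᵢ≡0 Mᵢⱼ≢0 with reciprocal (0<p*p Mᵢⱼ≢0)
... | d , _ , b²d≡1 = δ j +[ s ] δ i , subst (_< 0ℚ) (sym quad≡-1) (ℚ.neg-antimono-< 0<1)
  where
  open ≡-Reasoning
  b c s : ℚ
  b = M i j
  c = M j j
  s = - (½ * (c + 1ℚ) * b * d)
  quad≡-1 : quad M (δ j +[ s ] δ i) ≡ - 1ℚ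
  quad≡-1 = begin
    quad M (δ j +[ s ] δ i)
      ≡⟨ quad-comb M-sym (δ j) s (δ i) ⟩
    quad M (δ j) + 2ℚ * s * (δ i · M ⊛ δ j) + s * s * quad M (δ i)
      ≡⟨ cong₂ _+_ (cong₂ (λ x y → x + 2ℚ * s * y) (δ·⊛δ M j j) (δ·⊛δ M i j))
                   (trans (cong ((s * s) *_) (trans (δ·⊛δ M i i) Mᵢᵢ≡0)) (ℚ.*-zeroʳ (s * s))) ⟩
    c + 2ℚ * s * b + 0ℚ
      ≡⟨ solve 3 (λ c b d → c :+ con 2ℚ :* (:- (con ½ :* (c :+ con 1ℚ) :* b :* d)) :* b :+ con 0ℚ
                         := c :- (c :+ con 1ℚ) :* (b :* b :* d)) refl c b d ⟩
    c - (c + 1ℚ) * (b * b * d)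
      ≡⟨ cong (λ t → c - (c + 1ℚ) * t) b²d≡1 ⟩
    c - (c + 1ℚ) * 1ℚ
      ≡⟨ solve 1 (λ c → c :- (c :+ con 1ℚ) :* con 1ℚ := :- con 1ℚ) refl c ⟩
    - 1ℚ ∎

-- Symmetric Gaussian elimination. A positive pivot passes to the Schur complement, a negative one
-- is itself a counterexample, and a zero pivot is harmless exactly if its whole row is zero. A
-- failure is carried back to an explicit vector, through `minimiser` or by prepending 0.
positiveSemidefinite? : ∀ (M : ℚMatrix n) → IsSymmetric M → PositiveSemidefinite M ⊎ ∃[ x ] quad M x < 0ℚ
positiveSemidefinite? {zero}  M M-sym = inj₁ (λ _ → ℚ.≤-refl)
positiveSemidefinite? {suc n} M M-sym = byPivot (ℚ.<-cmp 0ℚ a)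
  where
  open Schur M M-sym
  open ≡-Reasoning

  Decision : Set
  Decision = PositiveSemidefinite M ⊎ ∃[ x ] quad M x < 0ℚ

  positivePivot : ∀ {d} → 0ℚ < a → a * d ≡ 1ℚ → Decision
  positivePivot {d} 0<a a*d≡1 =
    [ (λ psd → inj₁ (λ x → subst (0ℚ ≤_) (sym (quad-square a*d≡1 x))
        (0≤-+ (0≤-* (ℚ.<⇒≤ 0<a) (0≤p*p (x zero + d * (b · (x ∘ suc))))) (psd (x ∘ suc)))))
    , (λ (y , y<0) → inj₂ (minimiser a*d≡1 y , subst (_< 0ℚ) (sym (quad-minimiser a*d≡1 y)) y<0))
    ]′ (positiveSemidefinite? (complement a*d≡1) (complement-sym a*d≡1))

  quad-zeroPivot : a ≡ 0ℚ → (∀ i → b i ≡ 0ℚ) → ∀ x → quad M x ≡ quad C (x ∘ suc)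
  quad-zeroPivot a≡0 b≡0 x = begin
    quad M x
      ≡⟨ quad-block x ⟩
    a * x zero * x zero + 2ℚ * x zero * (b · (x ∘ suc)) + quad C (x ∘ suc)
      ≡⟨ cong₂ (λ s t → s * x zero * x zero + 2ℚ * x zero * t + quad C (x ∘ suc)) a≡0
               (trans (·-comm b (x ∘ suc)) (·-zeroʳ (x ∘ suc) b≡0)) ⟩
    0ℚ * x zero * x zero + 2ℚ * x zero * 0ℚ + quad C (x ∘ suc)
      ≡⟨ solve 2 (λ x c → con 0ℚ :* x :* x :+ con 2ℚ :* x :* con 0ℚ :+ c := c) refl (x zero) (quad C (x ∘ suc)) ⟩
    quad C (x ∘ suc) ∎

  zeroPivot : a ≡ 0ℚ → Dec (∀ i → b i ≡ 0ℚ) → Decision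
  zeroPivot a≡0 (no b≢0) = inj₂ (let i , bᵢ≢0 = Fin.¬∀⟶∃¬ n _ (λ i → b i ℚ.≟ 0ℚ) b≢0 in indefinite M M-sym a≡0 bᵢ≢0)
  zeroPivot a≡0 (yes b≡0) =
    [ (λ psd → inj₁ (λ x → subst (0ℚ ≤_) (sym (quad-zeroPivot a≡0 b≡0 x)) (psd (x ∘ suc))))
    , (λ (y , y<0) → inj₂ (0ℚ ∷ y , subst (_< 0ℚ) (sym (quad-minor zero M (0ℚ ∷ y) refl)) y<0))
    ]′ (positiveSemidefinite? C (λ i j → M-sym (suc i) (suc j)))

  byPivot : Tri (0ℚ < a) (0ℚ ≡ a) (a < 0ℚ) → Decision
  byPivot (tri< 0<a _ _) = let _ , _ , a*d≡1 = reciprocal 0<a in positivePivot 0<a a*d≡1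
  byPivot (tri≈ _ 0≡a _) = zeroPivot (sym 0≡a) (Fin.all? (λ i → b i ℚ.≟ 0ℚ))
  byPivot (tri> _ _ a<0) = inj₂ (δ zero , subst (_< 0ℚ) (sym (δ·⊛δ M zero zero)) a<0)

-- Definiteness is stated with a constant because the same γ passes to the Schur complement:
-- `minimiser` does not shorten a vector, and it preserves the value of the form.
linearSystem : ∀ (M : ℚMatrix n) → IsSymmetric M → ∀ {γ} → 0ℚ < γ → (∀ x → γ * (x · x) ≤ quad M x) →
               ∀ (c : Vector ℚ n) → ∃[ x ] ∀ i → (M ⊛ x) i ≡ c i
linearSystem {zero}  M M-sym 0<γ pd c = c , λ ()
linearSystem {suc n} M M-sym {γ} 0<γ pd c = x₀ ∷ y , solution
  where
  open Schur M M-sym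
  open ≡-Reasoning
  0<a : 0ℚ < a
  0<a = ℚ.<-≤-trans (subst (0ℚ <_) (sym (trans (cong (γ *_) (δ-· zero (δ {suc n} zero))) (ℚ.*-identityʳ γ))) 0<γ)
                  (subst (γ * (δ {suc n} zero · δ zero) ≤_) (δ·⊛δ M zero zero) (pd (δ zero)))

  d : ℚ
  d = proj₁ (reciprocal 0<a)

  a*d≡1 : a * d ≡ 1ℚ
  a*d≡1 = proj₂ (proj₂ (reciprocal 0<a))

  reduced : ∃[ y ] ∀ i → (complement a*d≡1 ⊛ y) i ≡ c (suc i) - d * c zero * b i
  reduced = linearSystem (complement a*d≡1) (complement-sym a*d≡1) 0<γ
    (λ y → subst (γ * (y · y) ≤_) (quad-minimiser a*d≡1 y)
      (ℚ.≤-trans (*-monoˡ-≤ (ℚ.<⇒≤ 0<γ) (≤-by (0≤p*p (- (d * (b · y)))) (ℚ.+-comm _ (y · y)))) (pd (minimiser a*d≡1 y))))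
    (λ i → c (suc i) - d * c zero * b i)

  y : Vector ℚ n
  y = proj₁ reduced

  x₀ : ℚ
  x₀ = d * (c zero - b · y)

  solution : ∀ i → (M ⊛ (x₀ ∷ y)) i ≡ c i
  solution zero = begin
    a * (d * (c zero - b · y)) + b · y   ≡⟨ cong (_+ (b · y)) (ℚ.*-assoc a d (c zero - b · y)) ⟨
    a * d * (c zero - b · y) + b · y     ≡⟨ cong (λ t → t * (c zero - b · y) + b · y) a*d≡1 ⟩
    1ℚ * (c zero - b · y) + b · y        ≡⟨ solve 2 (λ c t → con 1ℚ :* (c :- t) :+ t := c) refl (c zero) (b · y) ⟩
    c zero                               ∎
  solution (suc i) = begin
    M (suc i) zero * x₀ + (C ⊛ y) i
      ≡⟨ cong (λ m → m * x₀ + (C ⊛ y) i) (M-sym (suc i) zero) ⟩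
    b i * (d * (c zero - b · y)) + (C ⊛ y) i
      ≡⟨ solve 5 (λ b d c t u → b :* (d :* (c :- t)) :+ u := (u :+ (:- (d :* t)) :* b) :+ d :* c :* b)
           refl (b i) d (c zero) (b · y) ((C ⊛ y) i) ⟩
    ((C ⊛ y) i + (- (d * (b · y))) * b i) + d * c zero * b i
      ≡⟨ cong (_+ (d * c zero * b i)) (trans (sym (complement-⊛ a*d≡1 y i)) (proj₂ reduced i)) ⟩
    (c (suc i) - d * c zero * b i) + d * c zero * b i
      ≡⟨ solve 2 (λ c t → c :- t :+ t := c) refl (c (suc i)) (d * c zero * b i) ⟩
    c (suc i) ∎

-- Upper bounds on a quadratic form

infix 4 _⪯_

-- The Loewner order M ≤ tI; for symmetric `M` it says that no eigenvalue exceeds t.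
_⪯_ : ℚMatrix n → ℚ → Set
M ⪯ t = ∀ x → quad M x ≤ t * (x · x)

neg : ℚMatrix n → ℚMatrix n
neg M i j = - M i j

shift : ℚ → ℚMatrix n → ℚMatrix n
shift q M i = neg M i +[ q ] δ i

shift-sym : ∀ q {M : ℚMatrix n} → IsSymmetric M → IsSymmetric (shift q M)
shift-sym q M-sym i j = cong₂ (λ a b → - a + q * b) (M-sym i j) (δ-sym i j)

·-negˡ : ∀ (x y : Vector ℚ n) → (λ i → - x i) · y ≡ - (x · y)
·-negˡ x y = begin
  sum (λ i → - x i * y i)
    ≡⟨ sum-cong-≗ (λ i → solve 2 (λ x y → (:- x) :* y := con (- 1ℚ) :* (x :* y)) refl (x i) (y i)) ⟩
  sum (λ i → - 1ℚ * (x i * y i))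
    ≡⟨ *-distribˡ-sum (- 1ℚ) (λ i → x i * y i) ⟨
  - 1ℚ * (x · y)
    ≡⟨ solve 1 (λ t → con (- 1ℚ) :* t := :- t) refl (x · y) ⟩
  - (x · y) ∎
  where open ≡-Reasoning

·-negʳ : ∀ (x y : Vector ℚ n) → x · (λ i → - y i) ≡ - (x · y)
·-negʳ x y = trans (·-comm x (λ i → - y i)) (trans (·-negˡ y x) (cong -_ (·-comm y x)))

shift-⊛ : ∀ q (M : ℚMatrix n) x i → (shift q M ⊛ x) i ≡ - (M ⊛ x) i + q * x i
shift-⊛ q M x i = trans (·-combˡ (neg M i) q (δ i) x) (cong₂ (λ a b → a + q * b) (·-negˡ (M i) x) (δ-· i x))

quad-shift : ∀ q (M : ℚMatrix n) x → quad (shift q M) x ≡ - quad M x + q * (x · x)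
quad-shift q M x = begin
  x · shift q M ⊛ x                           ≡⟨ ·-congʳ x (shift-⊛ q M x) ⟩
  x · ((λ i → - (M ⊛ x) i) +[ q ] x)          ≡⟨ ·-combʳ x (λ i → - (M ⊛ x) i) q x ⟩
  x · (λ i → - (M ⊛ x) i) + q * (x · x)       ≡⟨ cong (_+ q * (x · x)) (·-negʳ x (M ⊛ x)) ⟩
  - quad M x + q * (x · x)                    ∎
  where open ≡-Reasoning

·-square-comb : ∀ (x : Vector ℚ n) c y →
                (x +[ c ] y) · (x +[ c ] y) ≡ x · x + 2ℚ * c * (x · y) + c * c * (y · y)
·-square-comb x c y = begin
  (x +[ c ] y) · (x +[ c ] y)
    ≡⟨ ·-combˡ x c y (x +[ c ] y) ⟩
  x · (x +[ c ] y) + c * (y · (x +[ c ] y))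
    ≡⟨ cong₂ (λ a b → a + c * b) (·-combʳ x x c y) (·-combʳ y x c y) ⟩
  (x · x + c * (x · y)) + c * (y · x + c * (y · y))
    ≡⟨ cong (λ t → (x · x + c * (x · y)) + c * (t + c * (y · y))) (·-comm y x) ⟩
  (x · x + c * (x · y)) + c * (x · y + c * (y · y))
    ≡⟨ solve 4 (λ A B C c → (A :+ c :* B) :+ c :* (B :+ c :* C) := A :+ con 2ℚ :* c :* B :+ c :* c :* C)
         refl (x · x) (x · y) (y · y) c ⟩
  x · x + 2ℚ * c * (x · y) + c * c * (y · y) ∎
  where open ≡-Reasoning

-- Expanding |x - y|² ≥ 0 replaces the Cauchy-Schwarz inequality here and avoids square roots.
x·y≤ : ∀ (x y : Vector ℚ n) → x · x ≤ p → y · y ≤ p → x · y ≤ p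
x·y≤ {p = p} x y x·x≤p y·y≤p = *-cancelˡ-≤ 0<2 (≤-by
  (0≤-+ (0≤-+ (p≤q⇒0≤q-p x·x≤p) (p≤q⇒0≤q-p y·y≤p)) (0≤x·x (x +[ - 1ℚ ] y)))
  (sym (trans (cong (λ t → 2ℚ * (x · y) + (p - x · x + (p - y · y) + t)) (·-square-comb x (- 1ℚ) y))
    (solve 4 (λ X B Y p → con 2ℚ :* B :+ (p :- X :+ (p :- Y) :+ (X :+ con 2ℚ :* con (- 1ℚ) :* B :+ con (- 1ℚ) :* con (- 1ℚ) :* Y))
                       := con 2ℚ :* p) refl (x · x) (x · y) (y · y) p))))

∣x·y∣≤ : ∀ (x y : Vector ℚ n) → x · x ≤ p → y · y ≤ p → ∣ x · y ∣ ≤ p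
∣x·y∣≤ {p = p} x y x·x≤p y·y≤p = ∣p∣≤ (x·y≤ x y x·x≤p y·y≤p)
  (subst (_≤ p) (·-negˡ x y) (x·y≤ (λ i → - x i) y (subst (_≤ p) (sym -x·-x≡x·x) x·x≤p) y·y≤p))
  where
  -x·-x≡x·x : (λ i → - x i) · (λ i → - x i) ≡ x · x
  -x·-x≡x·x = trans (·-negˡ x (λ i → - x i)) (trans (cong -_ (·-negʳ x x)) (solve 1 (λ t → :- (:- t) := t) refl (x · x)))

shift-psd⇒⪯ : ∀ {M : ℚMatrix n} {t} → PositiveSemidefinite (shift t M) → M ⪯ t
shift-psd⇒⪯ {M = M} {t} psd x = ≤-by (psd x) (sym (trans (cong (quad M x +_) (quad-shift t M x))
  (solve 2 (λ a b → a :+ (:- a :+ b) := b) refl (quad M x) (t * (x · x)))))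

⪯? : ∀ (M : ℚMatrix n) → IsSymmetric M → ∀ t → M ⪯ t ⊎ ∃[ x ] t * (x · x) < quad M x
⪯? M M-sym t = [ (λ psd → inj₁ (shift-psd⇒⪯ {M = M} {t} psd))
               , (λ (x , x<0) → inj₂ (x , <-by (ℚ.neg-antimono-< x<0) (sym (trans (cong (λ a → t * (x · x) + - a) (quad-shift t M x))
                   (solve 2 (λ a b → b :+ :- (:- a :+ b) := a) refl (quad M x) (t * (x · x)))))))
               ]′ (positiveSemidefinite? (shift t M) (shift-sym t M-sym))

-- The excess is divided by 1 + x·x. The summand 1 keeps the divisor positive and leaves a part of
-- the excess over, so that the new inequality is again strict.
exceed-gap : ∀ (M : ℚMatrix n) {t x} → t * (x · x) < quad M x → ∃[ γ ] 0ℚ < γ × (t + γ) * (x · x) < quad M x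
exceed-gap M {t} {x} t<M with reciprocal (0<-+ʳ 0<1 (0≤x·x x))
... | d , 0<d , eq = e * d , 0<-* 0<e 0<d , <-by (0<-* 0<e 0<d) (begin
    quad M x
      ≡⟨ solve 2 (λ m t → m := t :+ (m :- t) :* con 1ℚ) refl (quad M x) (t * (x · x)) ⟩
    t * (x · x) + e * 1ℚ
      ≡⟨ cong (λ s → t * (x · x) + e * s) eq ⟨
    t * (x · x) + e * ((1ℚ + x · x) * d)
      ≡⟨ solve 4 (λ t y e d → t :* y :+ e :* ((con 1ℚ :+ y) :* d) := (t :+ e :* d) :* y :+ e :* d) refl t (x · x) e d ⟩
    (t + e * d) * (x · x) + e * d ∎)
  where
  open ≡-Reasoning
  e : ℚ
  e = quad M x - t * (x · x)
  0<e : 0ℚ < e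
  0<e = p<q⇒0<q-p t<M

-- The eigenvector equation away from the coordinate v

record OffEigenvector (v : Fin (suc n)) (M : ℚMatrix (suc n)) (q : ℚ) (x : Vector ℚ (suc n)) : Set where
  constructor off
  field
    xᵥ≡1     : x v ≡ 1ℚ
    equation : ∀ i → (M ⊛ x) (punchIn v i) ≡ q * x (punchIn v i)

open OffEigenvector

-- The Schur complement of qI - M onto the coordinate v: it increases with q and vanishes at the top eigenvalue.
defect : Fin (suc n) → ℚMatrix (suc n) → ℚ → Vector ℚ (suc n) → ℚ
defect v M q x = q - (M ⊛ x) v

-- With d = 1/γ, a bound on |x|² uniform in all parameters q at distance at least γ above the minor.
offBound : Fin (suc n) → ℚMatrix (suc n) → ℚ → ℚ
offBound v M d = 1ℚ + d * d * (c · c)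
  where
  c : Vector ℚ _
  c i = M (punchIn v i) v

-- With the v-coordinate set to 1, the remaining equations read (qI - minor) y = c, where c is the
-- v-th column of `M` off v. This matrix is definite with constant γ because q lies at least γ above
-- the bound t of the minor.
offEigenvector : ∀ (v : Fin (suc n)) M → IsSymmetric M → ∀ {t γ d q} → 0ℚ < γ → γ * d ≡ 1ℚ → minor v M ⪯ t → t + γ ≤ q →
                 ∃[ x ] OffEigenvector v M q x × x · x ≤ offBound v M d
offEigenvector {n} v M M-sym {t} {γ} {d} {q} 0<γ γd≡1 M⪯t t+γ≤q = x , off (insertAt-lookup y v 1ℚ) x-equation , bound
  where
  open ≡-Reasoning
  P : ℚMatrix n
  P = shift q (minor v M)

  c : Vector ℚ n
  c i = M (punchIn v i) v

  P-pd : ∀ z → γ * (z · z) ≤ quad P z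
  P-pd z = ≤-by (0≤-+ (p≤q⇒0≤q-p (M⪯t z)) (0≤-* (p≤q⇒0≤q-p t+γ≤q) (0≤x·x z)))
    (trans (quad-shift q (minor v M) z)
      (solve 5 (λ m q z t g → :- m :+ q :* z := g :* z :+ (t :* z :- m :+ (q :- (t :+ g)) :* z))
         refl (quad (minor v M) z) q (z · z) t γ))

  solution : ∃[ y ] ∀ i → (P ⊛ y) i ≡ c i
  solution = linearSystem P (shift-sym q (λ i j → M-sym (punchIn v i) (punchIn v j))) 0<γ P-pd c

  y : Vector ℚ n
  y = proj₁ solution

  x : Vector ℚ (suc n)
  x = insertAt y v 1ℚ

  x-equation : ∀ i → (M ⊛ x) (punchIn v i) ≡ q * x (punchIn v i)
  x-equation i = begin
    M (punchIn v i) · x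
      ≡⟨ ·-splitAt v (M (punchIn v i)) x ⟩
    c i * x v + (minor v M i) · (x ∘ punchIn v)
      ≡⟨ cong₂ (λ a b → c i * a + b) (insertAt-lookup y v 1ℚ) (·-congʳ (minor v M i) (insertAt-punchIn y v 1ℚ)) ⟩
    c i * 1ℚ + (minor v M ⊛ y) i
      ≡⟨ cong (λ a → a * 1ℚ + (minor v M ⊛ y) i) (trans (sym (proj₂ solution i)) (shift-⊛ q (minor v M) y i)) ⟩
    (- (minor v M ⊛ y) i + q * y i) * 1ℚ + (minor v M ⊛ y) i
      ≡⟨ solve 2 (λ a b → (:- a :+ b) :* con 1ℚ :+ a := b) refl ((minor v M ⊛ y) i) (q * y i) ⟩
    q * y i
      ≡⟨ cong (q *_) (insertAt-punchIn y v 1ℚ i) ⟨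
    q * x (punchIn v i) ∎

  γy·y≤y·c : γ * (y · y) ≤ y · c
  γy·y≤y·c = subst (γ * (y · y) ≤_) (·-congʳ y (proj₂ solution)) (P-pd y)

  -- Cauchy-Schwarz without roots: |c - γy|² ≥ 0 is added to 2γ times the inequality `γy·y≤y·c`.
  γ²y·y≤c·c : γ * γ * (y · y) ≤ c · c
  γ²y·y≤c·c = ≤-by (0≤-+ (0≤x·x (c +[ - γ ] y)) (0≤-* (ℚ.<⇒≤ (0<-* 0<2 0<γ)) (p≤q⇒0≤q-p γy·y≤y·c)))
    (sym (begin
      γ * γ * (y · y) + ((c +[ - γ ] y) · (c +[ - γ ] y) + 2ℚ * γ * (y · c - γ * (y · y)))
        ≡⟨ cong₂ (λ a b → γ * γ * (y · y) + (a + 2ℚ * γ * (b - γ * (y · y)))) (·-square-comb c (- γ) y) (·-comm y c) ⟩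
      γ * γ * (y · y) + (c · c + 2ℚ * (- γ) * (c · y) + (- γ) * (- γ) * (y · y) + 2ℚ * γ * (c · y - γ * (y · y)))
        ≡⟨ solve 4 (λ g Y C B → g :* g :* Y :+ (C :+ con 2ℚ :* (:- g) :* B :+ (:- g) :* (:- g) :* Y :+ con 2ℚ :* g :* (B :- g :* Y))
                             := C) refl γ (y · y) (c · c) (c · y) ⟩
      c · c ∎))

  bound : x · x ≤ offBound v M d
  bound = subst₂ _≤_ (sym x·x≡) refl (ℚ.+-monoʳ-≤ 1ℚ (*-monoˡ-≤ (0≤p*p d) γ²y·y≤c·c))
    where
    x·x≡ : x · x ≡ 1ℚ + d * d * (γ * γ * (y · y))
    x·x≡ = begin
      x · x
        ≡⟨ ·-splitAt v x x ⟩
      x v * x v + (x ∘ punchIn v) · (x ∘ punchIn v)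
        ≡⟨ cong₂ _+_ (cong₂ _*_ (insertAt-lookup y v 1ℚ) (insertAt-lookup y v 1ℚ))
             (trans (·-congʳ (x ∘ punchIn v) (insertAt-punchIn y v 1ℚ))
               (trans (·-comm (x ∘ punchIn v) y) (·-congʳ y (insertAt-punchIn y v 1ℚ)))) ⟩
      1ℚ * 1ℚ + y · y
        ≡⟨ solve 1 (λ y → con 1ℚ :* con 1ℚ :+ y := con 1ℚ :+ con 1ℚ :* con 1ℚ :* y) refl (y · y) ⟩
      1ℚ + 1ℚ * 1ℚ * (y · y)
        ≡⟨ cong (λ s → 1ℚ + s * s * (y · y)) γd≡1 ⟨
      1ℚ + (γ * d) * (γ * d) * (y · y)
        ≡⟨ solve 3 (λ g d y → con 1ℚ :+ (g :* d) :* (g :* d) :* y := con 1ℚ :+ d :* d :* (g :* g :* y)) refl γ d (y · y) ⟩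
      1ℚ + d * d * (γ * γ * (y · y)) ∎

module _ {v : Fin (suc n)} {M : ℚMatrix (suc n)} (M-sym : IsSymmetric M) where

  -- The vectors Mx and qx differ only in the coordinate v, and there by the defect.
  ·-⊛-off : ∀ {q x} → OffEigenvector v M q x → ∀ z → z · M ⊛ x ≡ q * (z · x) - z v * defect v M q x
  ·-⊛-off {q} {x} offx z = begin
    z · M ⊛ x
      ≡⟨ ·-splitAt v z (M ⊛ x) ⟩
    z v * m + z′ · ((M ⊛ x) ∘ punchIn v)
      ≡⟨ cong (z v * m +_) (trans (·-congʳ z′ (λ i → trans (equation offx i) (sym (ℚ.+-identityˡ (q * x (punchIn v i)))))) (trans (·-combʳ z′ (λ _ → 0ℚ) q x′) (cong (_+ q * (z′ · x′)) (·-zeroʳ z′ (λ _ → refl))))) ⟩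
    z v * m + (0ℚ + q * (z′ · x′))
      ≡⟨ solve 4 (λ z m q w → z :* m :+ (con 0ℚ :+ q :* w) := q :* (z :* con 1ℚ :+ w) :- z :* (q :- m)) refl (z v) m q (z′ · x′) ⟩
    q * (z v * 1ℚ + z′ · x′) - z v * (q - m)
      ≡⟨ cong (λ a → q * (z v * a + z′ · x′) - z v * (q - m)) (xᵥ≡1 offx) ⟨
    q * (z v * x v + z′ · x′) - z v * (q - m)
      ≡⟨ cong (λ a → q * a - z v * (q - m)) (·-splitAt v z x) ⟨
    q * (z · x) - z v * (q - m) ∎
    where
    open ≡-Reasoning
    m : ℚ
    m = (M ⊛ x) v
    z′ x′ : Vector ℚ n
    z′ = z ∘ punchIn v
    x′ = x ∘ punchIn v

  ·-⊛-off₁ : ∀ {q x} → OffEigenvector v M q x → ∀ z → z v ≡ 1ℚ → z · M ⊛ x ≡ q * (z · x) - defect v M q x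
  ·-⊛-off₁ {q} {x} offx z zᵥ≡1 = trans (·-⊛-off offx z)
    (cong (λ a → q * (z · x) - a) (trans (cong (_* defect v M q x) zᵥ≡1) (ℚ.*-identityˡ (defect v M q x))))

  ·-⊛-off₀ : ∀ {q x} → OffEigenvector v M q x → ∀ z → z v ≡ 0ℚ → z · M ⊛ x ≡ q * (z · x)
  ·-⊛-off₀ {q} {x} offx z zᵥ≡0 = trans (·-⊛-off offx z)
    (trans (cong (λ a → q * (z · x) - a) (trans (cong (_* defect v M q x) zᵥ≡0) (ℚ.*-zeroˡ (defect v M q x)))) (ℚ.+-identityʳ (q * (z · x))))

  -- The number y · Mx is computed in two ways, from the equation for `x` and, by symmetry, from the
  -- equation for `y`. With x · y bounded, the defect is thus Lipschitz in the parameter.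
  defect-diff : ∀ {q x r y} → OffEigenvector v M q x → OffEigenvector v M r y →
                defect v M q x ≡ defect v M r y + (q - r) * (x · y)
  defect-diff {q} {x} {r} {y} offx offy = begin
    f
      ≡⟨ solve 2 (λ f a → f := a :- (a :- f)) refl f (q * (y · x)) ⟩
    q * (y · x) - (q * (y · x) - f)
      ≡⟨ cong (λ a → q * (y · x) - a) (trans (sym (·-⊛-off₁ offx y (xᵥ≡1 offy))) (trans (·-⊛-sym M-sym y x) (·-⊛-off₁ offy x (xᵥ≡1 offx)))) ⟩
    q * (y · x) - (r * (x · y) - g)
      ≡⟨ cong (λ a → q * a - (r * (x · y) - g)) (·-comm y x) ⟩
    q * (x · y) - (r * (x · y) - g)
      ≡⟨ solve 4 (λ q r b g → q :* b :- (r :* b :- g) := g :+ (q :- r) :* b) refl q r (x · y) g ⟩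
    g + (q - r) * (x · y) ∎
    where
    open ≡-Reasoning
    f g : ℚ
    f = defect v M q x
    g = defect v M r y

  -- The form of qI - M takes the defect as its value at `x` itself.
  0≤defect : ∀ {q x} → OffEigenvector v M q x → M ⪯ q → 0ℚ ≤ defect v M q x
  0≤defect {q} {x} offx M⪯q = subst (0ℚ ≤_)
    (trans (cong (λ a → q * (x · x) - a) (·-⊛-off₁ offx x (xᵥ≡1 offx))) (solve 2 (λ a f → a :- (a :- f) := f) refl (q * (x · x)) (defect v M q x)))
    (p≤q⇒0≤q-p (M⪯q x))

  off-minor : ∀ t → minor v M ⪯ t → ∀ z → z v ≡ 0ℚ → quad M z ≤ t * (z · z)
  off-minor t M⪯t z zᵥ≡0 = subst₂ _≤_ (sym (quad-minor v M z zᵥ≡0)) (cong (t *_) (sym (·-minor v z zᵥ≡0))) (M⪯t (z ∘ punchIn v))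

  -- Write w = z + c x with c the v-coordinate of w. Since z vanishes at v, it is orthogonal to x
  -- for the form of qI - M. The value at w is therefore the value at z, which the minor controls,
  -- plus c² times the defect.
  0≤defect⇒⪯ : ∀ {q t x} → OffEigenvector v M q x → minor v M ⪯ t → t ≤ q → 0ℚ ≤ defect v M q x → M ⪯ q
  0≤defect⇒⪯ {q} {t} {x} offx M⪯t t≤q 0≤f w = ≤-by
    (0≤-+ (0≤-+ (p≤q⇒0≤q-p (off-minor t M⪯t z zᵥ≡0)) (0≤-* (p≤q⇒0≤q-p t≤q) (0≤x·x z))) (0≤-* (0≤p*p c) 0≤f))
    (begin
      q * (w · w)
        ≡⟨ cong (q *_) (trans (trans (·-congʳ w w≗) (trans (·-comm w w′) (·-congʳ w′ w≗))) (·-square-comb z c x)) ⟩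
      q * (z · z + 2ℚ * c * (z · x) + c * c * (x · x))
        ≡⟨ solve 8 (λ q Z c B X f Q t → q :* (Z :+ con 2ℚ :* c :* B :+ c :* c :* X)
                              := (Q :+ con 2ℚ :* c :* (q :* B) :+ c :* c :* (q :* X :- f)) :+ (t :* Z :- Q :+ (q :- t) :* Z :+ c :* c :* f))
             refl q (z · z) c (z · x) (x · x) f (quad M z) t ⟩
      (quad M z + 2ℚ * c * (q * (z · x)) + c * c * (q * (x · x) - f)) + rest
        ≡⟨ cong₂ (λ a b → (quad M z + 2ℚ * c * a + c * c * b) + rest)
             (trans (sym (·-⊛-off₀ offx z zᵥ≡0)) (·-⊛-sym M-sym z x)) (sym (·-⊛-off₁ offx x (xᵥ≡1 offx))) ⟩
      (quad M z + 2ℚ * c * (x · M ⊛ z) + c * c * quad M x) + rest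
        ≡⟨ cong (_+ rest) (quad-comb M-sym z c x) ⟨
      quad M w′ + rest
        ≡⟨ cong (_+ rest) (trans (·-congʳ w′ (λ i → ·-congʳ (M i) (λ j → sym (w≗ j)))) (trans (·-comm w′ (M ⊛ w)) (trans (·-congʳ (M ⊛ w) (λ j → sym (w≗ j))) (·-comm (M ⊛ w) w)))) ⟩
      quad M w + rest ∎)
    where
    open ≡-Reasoning
    c f : ℚ
    c = w v
    f = defect v M q x
    z w′ : Vector ℚ (suc n)
    z = w +[ - c ] x
    w′ = z +[ c ] x
    rest : ℚ
    rest = t * (z · z) - quad M z + (q - t) * (z · z) + c * c * f
    zᵥ≡0 : z v ≡ 0ℚ
    zᵥ≡0 = trans (cong (λ a → c + (- c) * a) (xᵥ≡1 offx)) (solve 1 (λ c → c :+ (:- c) :* con 1ℚ := con 0ℚ) refl c)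
    w≗ : ∀ i → w i ≡ w′ i
    w≗ i = solve 3 (λ w c x → w := w :+ (:- c) :* x :+ c :* x) refl (w i) c (x i)

  -- The difference z vanishes at v, so the minor bounds its form by t |z|². The two equations give
  -- q |z|² + (q - r)(z · y) for the same form, and comparison leaves γ |z|² at most -(q - r)(z ·
  -- y). Hence x depends on q with Hölder exponent 1/2.
  off-distance : ∀ {t γ q r x y B} → minor v M ⪯ t → t + γ ≤ q → OffEigenvector v M q x → OffEigenvector v M r y →
                 x · x ≤ B → y · y ≤ B → let z = x +[ - 1ℚ ] y in γ * (z · z) ≤ ∣ q - r ∣ * (2ℚ * B)
  off-distance {t} {γ} {q} {r} {x} {y} {B} M⪯t t+γ≤q offx offy x≤B y≤B =
    ℚ.≤-trans (≤-by (0≤-+ (p≤q⇒0≤q-p (off-minor t M⪯t z zᵥ≡0)) (0≤-* (p≤q⇒0≤q-p t+γ≤q) (0≤x·x z))) expand)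
   (ℚ.≤-trans (p≤∣p∣ (- ((q - r) * (z · y))))
   (ℚ.≤-trans (ℚ.≤-reflexive (trans (ℚ.∣-p∣≡∣p∣ ((q - r) * (z · y))) (ℚ.∣p*q∣≡∣p∣*∣q∣ (q - r) (z · y))))
   (*-monoˡ-≤ (ℚ.0≤∣p∣ (q - r)) z·y≤)))
    where
    open ≡-Reasoning
    z : Vector ℚ (suc n)
    z = x +[ - 1ℚ ] y
    zᵥ≡0 : z v ≡ 0ℚ
    zᵥ≡0 = cong₂ (λ a b → a + (- 1ℚ) * b) (xᵥ≡1 offx) (xᵥ≡1 offy)
    quad-z : quad M z ≡ q * (z · z) + (q - r) * (z · y)
    quad-z = begin
      z · M ⊛ z
        ≡⟨ ·-congʳ z (λ i → ·-combʳ (M i) x (- 1ℚ) y) ⟩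
      z · (M ⊛ x +[ - 1ℚ ] M ⊛ y)
        ≡⟨ ·-combʳ z (M ⊛ x) (- 1ℚ) (M ⊛ y) ⟩
      z · M ⊛ x + - 1ℚ * (z · M ⊛ y)
        ≡⟨ cong₂ (λ a b → a + - 1ℚ * b) (·-⊛-off₀ offx z zᵥ≡0) (·-⊛-off₀ offy z zᵥ≡0) ⟩
      q * (z · x) + - 1ℚ * (r * (z · y))
        ≡⟨ solve 4 (λ q r a b → q :* a :+ con (- 1ℚ) :* (r :* b) := q :* (a :+ con (- 1ℚ) :* b) :+ (q :- r) :* b) refl q r (z · x) (z · y) ⟩
      q * (z · x + - 1ℚ * (z · y)) + (q - r) * (z · y)
        ≡⟨ cong (λ a → q * a + (q - r) * (z · y)) (·-combʳ z x (- 1ℚ) y) ⟨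
      q * (z · z) + (q - r) * (z · y) ∎
    expand : - ((q - r) * (z · y)) ≡ γ * (z · z) + (t * (z · z) - quad M z + (q - (t + γ)) * (z · z))
    expand = sym (trans (cong (λ a → γ * (z · z) + (t * (z · z) - a + (q - (t + γ)) * (z · z))) quad-z)
      (solve 6 (λ g Z t q r b → g :* Z :+ (t :* Z :- (q :* Z :+ (q :- r) :* b) :+ (q :- (t :+ g)) :* Z) := :- ((q :- r) :* b))
         refl γ (z · z) t q r (z · y)))
    z·y≤ : ∣ z · y ∣ ≤ 2ℚ * B
    z·y≤ = ℚ.≤-trans (subst (λ a → ∣ a ∣ ≤ ∣ x · y ∣ + ∣ y · y ∣)
             (trans (solve 2 (λ a b → a :- b := a :+ con (- 1ℚ) :* b) refl (x · y) (y · y)) (sym (·-combˡ x (- 1ℚ) y y)))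
             (ℚ.∣p-q∣≤∣p∣+∣q∣ (x · y) (y · y)))
      (ℚ.≤-trans (ℚ.+-mono-≤ (∣x·y∣≤ x y x≤B y≤B) (∣x·y∣≤ y y y≤B y≤B)) (ℚ.≤-reflexive (solve 1 (λ b → b :+ b := con 2ℚ :* b) refl B)))

-- Null and bounded sequences

Null : (ℕ → ℚ) → Set
Null s = ∀ ε → 0ℚ < ε → ∃[ N ] ∀ n → N ℕ.≤ n → ∣ s n ∣ < ε

Bounded : (ℕ → ℚ) → Set
Bounded s = ∃[ B ] 0ℚ < B × ∃[ N ] ∀ n → N ℕ.≤ n → ∣ s n ∣ ≤ B

null-cong : ∀ {s t} → (∀ n → s n ≡ t n) → Null s → Null t
null-cong s≗t s-null ε 0<ε = let N , s<ε = s-null ε 0<ε in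
  N , λ n N≤n → subst (λ a → ∣ a ∣ < ε) (s≗t n) (s<ε n N≤n)

null-0 : Null (λ _ → 0ℚ)
null-0 ε 0<ε = 0 , λ _ _ → 0<ε

null-shift : ∀ N {s} → Null s → Null (λ k → s (N ℕ.+ k))
null-shift N s-null ε 0<ε = let K , s<ε = s-null ε 0<ε in
  K , λ n K≤n → s<ε (N ℕ.+ n) (ℕ.≤-trans K≤n (ℕ.m≤n+m n N))

cauchy-shift : ∀ N {s} → IsCauchy s → IsCauchy (λ k → s (N ℕ.+ k))
cauchy-shift N s-cauchy ε 0<ε = let K , s<ε = s-cauchy ε 0<ε in
  K , λ m n K≤m K≤n → s<ε (N ℕ.+ m) (N ℕ.+ n) (ℕ.≤-trans K≤m (ℕ.m≤n+m m N)) (ℕ.≤-trans K≤n (ℕ.m≤n+m n N))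

halves : ∀ p → ½ * p + ½ * p ≡ p
halves = solve 1 (λ p → con ½ :* p :+ con ½ :* p := p) refl

null-+ : ∀ {s t} → Null s → Null t → Null (λ n → s n + t n)
null-+ {s} {t} s-null t-null ε 0<ε =
  let K , s< = s-null (½ * ε) (0<-* 0<½ 0<ε)
      N , t< = t-null (½ * ε) (0<-* 0<½ 0<ε)
  in K ℕ.⊔ N , λ n n≥ → ℚ.≤-<-trans (ℚ.∣p+q∣≤∣p∣+∣q∣ (s n) (t n))
       (subst (∣ s n ∣ + ∣ t n ∣ <_) (halves ε) (ℚ.+-mono-< (s< n (ℕ.m⊔n≤o⇒m≤o K N n≥)) (t< n (ℕ.m⊔n≤o⇒n≤o K N n≥))))

null-neg : ∀ {s} → Null s → Null (λ n → - s n)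
null-neg {s} s-null ε 0<ε = let N , s<ε = s-null ε 0<ε in
  N , λ n N≤n → subst (_< ε) (sym (ℚ.∣-p∣≡∣p∣ (s n))) (s<ε n N≤n)

null-- : ∀ {s t} → Null s → Null t → Null (λ n → s n - t n)
null-- s-null t-null = null-+ s-null (null-neg t-null)

p+-1*q≡p-q : ∀ p q → p + - 1ℚ * q ≡ p - q
p+-1*q≡p-q = solve 2 (λ p q → p :+ con (- 1ℚ) :* q := p :- q) refl

divide : ∀ {c} → 0ℚ < c → 0ℚ < p → ∃[ q ] 0ℚ < q × c * q ≡ p
divide {p} {c} 0<c 0<p = let d , 0<d , cd≡1 = reciprocal 0<c in
  d * p , 0<-* 0<d 0<p , trans (sym (ℚ.*-assoc c d p)) (trans (cong (_* p) cd≡1) (ℚ.*-identityˡ p))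

*-cancelˡ-< : 0ℚ < r → r * p < r * q → p < q
*-cancelˡ-< {r} 0<r = ℚ.*-cancelˡ-<-nonNeg r {{ℚ.nonNegative (ℚ.<⇒≤ 0<r)}}

null-* : ∀ {s t} → Bounded s → Null t → Null (λ n → s n * t n)
null-* {s} {t} (B , 0<B , K , s≤B) t-null ε 0<ε =
  let e , 0<e , Be≡ε = divide 0<B 0<ε
      N , t<e = t-null e 0<e
  in K ℕ.⊔ N , λ n n≥ → ℚ.≤-<-trans (ℚ.≤-reflexive (ℚ.∣p*q∣≡∣p∣*∣q∣ (s n) (t n)))
       (ℚ.≤-<-trans (subst₂ _≤_ (ℚ.*-comm ∣ t n ∣ ∣ s n ∣) (ℚ.*-comm ∣ t n ∣ B) (*-monoˡ-≤ (ℚ.0≤∣p∣ (t n)) (s≤B n (ℕ.m⊔n≤o⇒m≤o K N n≥))))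
       (subst (B * ∣ t n ∣ <_) Be≡ε (*-monoˡ-< 0<B (t<e n (ℕ.m⊔n≤o⇒n≤o K N n≥)))))

null-squeeze : ∀ {s t γ} → 0ℚ < γ → Null t → (∃[ N ] ∀ n → N ℕ.≤ n → γ * ∣ s n ∣ ≤ ∣ t n ∣) → Null s
null-squeeze 0<γ t-null (K , s≤t) ε 0<ε =
  let N , t<γε = t-null _ (0<-* 0<γ 0<ε) in
  K ℕ.⊔ N , λ n n≥ → *-cancelˡ-< 0<γ (ℚ.≤-<-trans (s≤t n (ℕ.m⊔n≤o⇒m≤o K N n≥)) (t<γε n (ℕ.m⊔n≤o⇒n≤o K N n≥)))

null-sqrt : ∀ {s} → Null (λ n → s n * s n) → Null s
null-sqrt {s} s²-null ε 0<ε = let N , s²< = s²-null (ε * ε) (0<-* 0<ε 0<ε) in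
  N , λ n N≤n → square-cancel-< 0<ε (ℚ.≤-<-trans (p≤∣p∣ (s n * s n)) (s²< n N≤n))

cauchy⇒bounded : ∀ {s} → IsCauchy s → Bounded s
cauchy⇒bounded {s} s-cauchy = let N , s<1 = s-cauchy 1ℚ 0<1 in
  1ℚ + ∣ s N ∣ , 0<-+ʳ 0<1 (ℚ.0≤∣p∣ (s N)) , N , λ n N≤n →
    ℚ.≤-trans (ℚ.≤-reflexive (cong ∣_∣ (solve 2 (λ a b → a := a :- b :+ b) refl (s n) (s N))))
      (ℚ.≤-trans (ℚ.∣p+q∣≤∣p∣+∣q∣ (s n - s N) (s N)) (ℚ.+-monoˡ-≤ ∣ s N ∣ (ℚ.<⇒≤ (s<1 n N N≤n ℕ.≤-refl))))

bounded-const : ∀ c → Bounded (λ _ → c)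
bounded-const c = 1ℚ + ∣ c ∣ , 0<-+ʳ 0<1 (ℚ.0≤∣p∣ c) , 0 , λ _ _ → ≤-by (ℚ.<⇒≤ 0<1) (ℚ.+-comm 1ℚ ∣ c ∣)

bounded-∣∣ : ∀ {s} → Bounded s → Bounded (λ n → ∣ s n ∣)
bounded-∣∣ {s} (B , 0<B , N , s≤B) = B , 0<B , N , λ n N≤n → subst (_≤ B) (sym (ℚ.∣∣p∣∣≡∣p∣ (s n))) (s≤B n N≤n)

bounded-+ : ∀ {s t} → Bounded s → Bounded t → Bounded (λ n → s n + t n)
bounded-+ {s} {t} (B , 0<B , K , s≤B) (C , 0<C , N , t≤C) =
  B + C , 0<-+ 0<B 0<C , K ℕ.⊔ N , λ n n≥ → ℚ.≤-trans (ℚ.∣p+q∣≤∣p∣+∣q∣ (s n) (t n))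
    (ℚ.+-mono-≤ (s≤B n (ℕ.m⊔n≤o⇒m≤o K N n≥)) (t≤C n (ℕ.m⊔n≤o⇒n≤o K N n≥)))

bounded-* : ∀ {s t} → Bounded s → Bounded t → Bounded (λ n → s n * t n)
bounded-* {s} {t} (B , 0<B , K , s≤B) (C , 0<C , N , t≤C) =
  B * C , 0<-* 0<B 0<C , K ℕ.⊔ N , λ n n≥ → ℚ.≤-trans (ℚ.≤-reflexive (ℚ.∣p*q∣≡∣p∣*∣q∣ (s n) (t n)))
    (ℚ.≤-trans (*-monoˡ-≤ (ℚ.0≤∣p∣ (s n)) (t≤C n (ℕ.m⊔n≤o⇒n≤o K N n≥)))
      (subst₂ _≤_ (ℚ.*-comm C ∣ s n ∣) (ℚ.*-comm C B) (*-monoˡ-≤ (ℚ.<⇒≤ 0<C) (s≤B n (ℕ.m⊔n≤o⇒m≤o K N n≥)))))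

null-· : ∀ {x y : ℕ → Vector ℚ n} → (∀ i → Bounded (λ k → x k i)) → (∀ i → Null (λ k → y k i)) → Null (λ k → x k · y k)
null-· {zero}  x-bdd y-null = null-0
null-· {suc n} x-bdd y-null = null-+ (null-* (x-bdd zero) (y-null zero)) (null-· (x-bdd ∘ suc) (y-null ∘ suc))

null-norm⇒null : ∀ {x : ℕ → Vector ℚ n} → Null (λ k → x k · x k) → ∀ i → Null (λ k → x k i)
null-norm⇒null {x = x} x·x-null i = null-sqrt (null-squeeze 0<1 x·x-null (0 , λ k _ →
  subst₂ _≤_ (sym (trans (ℚ.*-identityˡ ∣ x k i * x k i ∣) (ℚ.0≤p⇒∣p∣≡p (0≤p*p (x k i))))) (sym (ℚ.0≤p⇒∣p∣≡p (0≤x·x (x k))))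
    (xᵢ*xᵢ≤x·x (x k) i)))

-- Approximate eigenvectors

Exceeds : ℚMatrix n → ℚ → Set
Exceeds M t = ∃[ x ] t * (x · x) < quad M x

exceeds⇒< : ∀ (M : ℚMatrix n) → Exceeds M p → M ⪯ q → p < q
exceeds⇒< {p = p} {q = q} M (x , p<M) M⪯q = ℚ.≰⇒> λ q≤p → ≤⇒≯
  (ℚ.≤-trans (M⪯q x) (subst₂ _≤_ (ℚ.*-comm (x · x) q) (ℚ.*-comm (x · x) p) (*-monoˡ-≤ (0≤x·x x) q≤p))) p<M

-- Rational data for a real eigenpair: `q` approximates the eigenvalue, and the constant coordinate
-- at `v` keeps the limit vector apart from 0.
record Eigensequence (M : ℚMatrix n) (q : ℕ → ℚ) (v : Fin n) : Set where
  field
    vec      : ℕ → Vector ℚ n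
    converge : ∀ i → IsCauchy (λ k → vec k i)
    residual : ∀ i → Null (λ k → (M ⊛ vec k) i - q k * vec k i)
    pivot    : ∀ k → vec k v ≡ 1ℚ

record Brackets (l u : ℕ → ℚ) (M : ℚMatrix n) : Set where
  field
    lower : ∀ k → Exceeds M (l k)
    upper : ∀ k → M ⪯ u k

open Brackets

-- The vectors belong to the upper ends u k. Off v their residual is exactly 0, and at v it is minus
-- the defect, which the brackets force to 0.
eigensequence : ∀ (v : Fin (suc n)) {M} → IsSymmetric M → ∀ {t γ l u} → 0ℚ < γ → minor v M ⪯ t → (∀ k → t + γ ≤ l k) →
                IsCauchy u → Null (λ k → u k - l k) → Brackets l u M → Eigensequence M u v
eigensequence {n} v {M} M-sym {t} {γ} {l} {u} 0<γ M⪯t t+γ≤l u-cauchy width-null brackets = record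
  { vec      = x
  ; converge = x-cauchy
  ; residual = λ i → x-residual i (v Fin.≟ i)
  ; pivot    = λ k → OffEigenvector.xᵥ≡1 (x-off k)
  }
  where
  d : ℚ
  d = proj₁ (reciprocal 0<γ)

  B : ℚ
  B = offBound v M d

  0<B : 0ℚ < B
  0<B = 0<-+ʳ 0<1 (0≤-* (0≤p*p d) (0≤x·x (λ i → M (punchIn v i) v)))

  solveAt : ∀ {q} → t + γ ≤ q → ∃[ x ] OffEigenvector v M q x × x · x ≤ B
  solveAt = offEigenvector v M M-sym {t = t} 0<γ (proj₂ (proj₂ (reciprocal 0<γ))) M⪯t

  l<u : ∀ k → l k < u k
  l<u k = exceeds⇒< M (lower brackets k) (upper brackets k)

  t+γ≤u : ∀ k → t + γ ≤ u k
  t+γ≤u k = ℚ.≤-trans (t+γ≤l k) (ℚ.<⇒≤ (l<u k))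

  x : ℕ → Vector ℚ (suc n)
  x k = proj₁ (solveAt (t+γ≤u k))

  x-off : ∀ k → OffEigenvector v M (u k) (x k)
  x-off k = proj₁ (proj₂ (solveAt (t+γ≤u k)))

  x≤B : ∀ k → x k · x k ≤ B
  x≤B k = proj₂ (proj₂ (solveAt (t+γ≤u k)))

  x-cauchy : ∀ i → IsCauchy (λ k → x k i)
  x-cauchy i ε 0<ε =
    let 0<γε² = 0<-* 0<γ (0<-* 0<ε 0<ε)
        -- `off-distance` bounds γ times the squared distance by 2B |u j - u k|, so a tolerance ε
        -- needs 2B e = γ ε².
        e , 0<e , 2Be≡γε² = divide (0<-* 0<2 0<B) 0<γε²
        N , u<e = u-cauchy e 0<e
    in N , λ j k N≤j N≤k → square-cancel-< {p = x j i - x k i} 0<ε (ℚ.≤-<-trans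
         (subst (_≤ (x j +[ - 1ℚ ] x k) · (x j +[ - 1ℚ ] x k)) (cong (λ a → a * a) (p+-1*q≡p-q (x j i) (x k i)))
           (xᵢ*xᵢ≤x·x (x j +[ - 1ℚ ] x k) i))
         (*-cancelˡ-< 0<γ (ℚ.≤-<-trans (off-distance M-sym {t = t} M⪯t (t+γ≤u j) (x-off j) (x-off k) (x≤B j) (x≤B k))
           (subst₂ _<_ (ℚ.*-comm (2ℚ * B) ∣ u j - u k ∣) 2Be≡γε² (*-monoˡ-< (0<-* 0<2 0<B) (u<e j k N≤j N≤k))))))

  -- The defect has opposite signs at the two ends: nonnegative at u k, and at l k not positive,
  -- since otherwise l k would bound the form. By `defect-diff` the two values differ by at most B
  -- times the width.
  defect-small : ∀ k → ∣ defect v M (u k) (x k) ∣ ≤ ∣ B * (u k - l k) ∣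
  defect-small k =
    let y , y-off , y≤B = solveAt (t+γ≤l k)
        fl = defect v M (l k) y
        w = u k - l k
        0≤w = p≤q⇒0≤q-p (ℚ.<⇒≤ (l<u k))
        fl≤0 : fl ≤ 0ℚ
        fl≤0 = ℚ.≮⇒≥ λ 0<fl → ℚ.<-irrefl refl (exceeds⇒< {p = l k} {q = l k} M (lower brackets k) (0≤defect⇒⪯ M-sym {t = t} y-off M⪯t
                 (ℚ.≤-trans (≤-by {q = t + γ} {p = t} (ℚ.<⇒≤ 0<γ) refl) (t+γ≤l k)) (ℚ.<⇒≤ 0<fl)))
    in subst₂ _≤_ (sym (ℚ.0≤p⇒∣p∣≡p (0≤defect M-sym (x-off k) (upper brackets k)))) (sym (ℚ.0≤p⇒∣p∣≡p (0≤-* (ℚ.<⇒≤ 0<B) 0≤w)))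
         (≤-by (0≤-+ (ℚ.neg-antimono-≤ fl≤0) (0≤-* 0≤w (p≤q⇒0≤q-p (x·y≤ (x k) y (x≤B k) y≤B))))
           (sym (trans (cong (_+ (- fl + w * (B - x k · y))) (defect-diff M-sym (x-off k) y-off))
             (solve 4 (λ f w c B → (f :+ w :* c) :+ (:- f :+ w :* (B :- c)) := B :* w) refl fl w (x k · y) B))))

  defect-null : Null (λ k → defect v M (u k) (x k))
  defect-null = null-squeeze 0<1 (null-* (bounded-const B) width-null)
    (0 , λ k _ → subst (_≤ ∣ B * (u k - l k) ∣) (sym (ℚ.*-identityˡ ∣ defect v M (u k) (x k) ∣)) (defect-small k))

  x-residual : ∀ i → Dec (v ≡ i) → Null (λ k → (M ⊛ x k) i - u k * x k i)
  x-residual i (yes refl) = null-cong (λ k → trans (solve 2 (λ q m → :- (q :- m) := m :- q :* con 1ℚ) refl (u k) ((M ⊛ x k) v))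
      (cong (λ a → (M ⊛ x k) v - u k * a) (sym (OffEigenvector.xᵥ≡1 (x-off k))))) (null-neg defect-null)
  x-residual i (no v≢i) = subst (λ i → Null (λ k → (M ⊛ x k) i - u k * x k i)) (punchIn-punchOut v≢i)
    (null-cong (λ k → sym (trans (cong (_- u k * x k (punchIn v (punchOut v≢i))) (OffEigenvector.equation (x-off k) (punchOut v≢i))) (ℚ.+-inverseʳ (u k * x k (punchIn v (punchOut v≢i)))))) null-0)

-- Cauchy-Schwarz for the semidefinite form of qI - M, applied to z and the i-th unit vector. It is
-- obtained by testing the form at w. Dividing by a positive D above the diagonal entry q - M i i
-- allows that entry to be 0.
squared-row≤ : ∀ {M : ℚMatrix n} → IsSymmetric M → ∀ {D} → 0ℚ < D → M ⪯ q → ∀ {i} → q - M i i ≤ D → ∀ z → z i ≡ 0ℚ →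
               (M ⊛ z) i * (M ⊛ z) i ≤ D * (q * (z · z) - quad M z)
squared-row≤ {q = q} {M = M} M-sym {D} 0<D M⪯q {i} q-Mᵢᵢ≤D z zᵢ≡0 with reciprocal 0<D
... | d , _ , Dd≡1 = ≤-by
    (0≤-+ (0≤-* (ℚ.<⇒≤ 0<D) (p≤q⇒0≤q-p (M⪯q w))) (0≤-* (0≤-* (ℚ.<⇒≤ 0<D) (0≤p*p s)) (p≤q⇒0≤q-p q-Mᵢᵢ≤D)))
    (begin
      D * (q * (z · z) - quad M z)
        ≡⟨ solve 6 (λ D q Z Q s a → D :* (q :* Z :- Q)
             := (D :* s) :* (D :* s) :+ (D :* (q :* (Z :+ con 2ℚ :* s :* con 0ℚ :+ s :* s :* con 1ℚ) :- (Q :+ con 2ℚ :* s :* (D :* s) :+ s :* s :* a))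
                 :+ D :* (s :* s) :* (D :- (q :- a)))) refl D q (z · z) (quad M z) s (M i i) ⟩
      (D * s) * (D * s) + (D * (q * (z · z + 2ℚ * s * 0ℚ + s * s * 1ℚ) - (quad M z + 2ℚ * s * (D * s) + s * s * M i i)) + rest)
        ≡⟨ cong (λ a → a * a + (D * (q * (z · z + 2ℚ * s * 0ℚ + s * s * 1ℚ) - (quad M z + 2ℚ * s * a + s * s * M i i)) + rest)) Ds≡m ⟩
      m * m + (D * (q * (z · z + 2ℚ * s * 0ℚ + s * s * 1ℚ) - (quad M z + 2ℚ * s * m + s * s * M i i)) + rest)
        ≡⟨ cong₂ (λ a b → m * m + (D * (q * a - b) + rest)) (sym w·w) (sym quad-w) ⟩
      m * m + (D * (q * (w · w) - quad M w) + rest) ∎)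
  where
  open ≡-Reasoning
  m s rest : ℚ
  m = (M ⊛ z) i
  s = d * m
  rest = D * (s * s) * (D - (q - M i i))
  w : Vector ℚ _
  w = z +[ s ] δ i
  Ds≡m : D * s ≡ m
  Ds≡m = trans (sym (ℚ.*-assoc D d m)) (trans (cong (_* m) Dd≡1) (ℚ.*-identityˡ m))
  w·w : w · w ≡ z · z + 2ℚ * s * 0ℚ + s * s * 1ℚ
  w·w = trans (·-square-comb z s (δ i)) (cong₂ (λ a b → z · z + 2ℚ * s * a + s * s * b)
    (trans (·-comm z (δ i)) (trans (δ-· i z) zᵢ≡0)) (trans (δ-· i (δ i)) (δᵢᵢ≡1 i)))
  quad-w : quad M w ≡ quad M z + 2ℚ * s * m + s * s * M i i
  quad-w = trans (quad-comb M-sym z s (δ i)) (cong₂ (λ a b → quad M z + 2ℚ * s * a + s * s * b) (δ-· i (M ⊛ z)) (δ·⊛δ M i i))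

minor-⪯ : ∀ (M : ℚMatrix (suc n)) q → M ⪯ q → minor zero M ⪯ q
minor-⪯ M q M⪯q y = subst₂ _≤_ (quad-minor zero M (0ℚ ∷ y) refl) (cong (q *_) (·-minor zero (0ℚ ∷ y) refl)) (M⪯q (0ℚ ∷ y))

-- An eigenvector of a principal submatrix for the top eigenvalue of the whole matrix is isotropic for a
-- semidefinite form, hence in its kernel.
extendByZero : ∀ {M : ℚMatrix (suc n)} → IsSymmetric M → ∀ {q} → IsCauchy q → (∀ k → M ⪯ q k) →
               ∀ {v} → Eigensequence (minor zero M) q v → Eigensequence M q (suc v)
extendByZero {n} {M} M-sym {q} q-cauchy M⪯q {v} es = record
  { vec      = z
  ; converge = z-cauchy
  ; residual = z-residual
  ; pivot    = pivot
  }
  where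
  open Eigensequence es renaming (vec to y)

  z : ℕ → Vector ℚ (suc n)
  z k = 0ℚ ∷ y k

  z-cauchy : ∀ i → IsCauchy (λ k → z k i)
  z-cauchy zero    = cauchy 0ℝ
  z-cauchy (suc i) = converge i

  m e D : ℕ → ℚ
  m k = (M ⊛ z k) zero
  e k = q k * (z k · z k) - quad M (z k)
  -- A bound for the diagonal entry q k - M zero zero that is positive for every k and bounded along
  -- the sequence.
  D k = ∣ q k ∣ + (1ℚ + ∣ M zero zero ∣)

  0<D : ∀ k → 0ℚ < D k
  0<D k = subst (0ℚ <_) (ℚ.+-comm (1ℚ + ∣ M zero zero ∣) ∣ q k ∣) (0<-+ʳ (0<-+ʳ 0<1 (ℚ.0≤∣p∣ (M zero zero))) (ℚ.0≤∣p∣ (q k)))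

  q-M≤D : ∀ k → q k - M zero zero ≤ D k
  q-M≤D k = ℚ.+-mono-≤ (p≤∣p∣ (q k)) (ℚ.≤-trans (-p≤∣p∣ (M zero zero)) (≤-by (ℚ.<⇒≤ 0<1) (ℚ.+-comm 1ℚ ∣ M zero zero ∣)))

  e≡ : ∀ k → - (y k · (λ i → (minor zero M ⊛ y k) i - q k * y k i)) ≡ e k
  e≡ k = begin
    - (y k · (λ i → (minor zero M ⊛ y k) i - q k * y k i))
      ≡⟨ cong -_ (·-congʳ (y k) (λ i → solve 3 (λ a q y → a :- q :* y := a :+ (:- q) :* y) refl ((minor zero M ⊛ y k) i) (q k) (y k i))) ⟩
    - (y k · (minor zero M ⊛ y k +[ - q k ] y k))
      ≡⟨ cong -_ (·-combʳ (y k) (minor zero M ⊛ y k) (- q k) (y k)) ⟩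
    - (quad (minor zero M) (y k) + (- q k) * (y k · y k))
      ≡⟨ solve 3 (λ a q y → :- (a :+ (:- q) :* y) := q :* y :- a) refl (quad (minor zero M) (y k)) (q k) (y k · y k) ⟩
    q k * (y k · y k) - quad (minor zero M) (y k)
      ≡⟨ cong₂ (λ a b → q k * a - b) (·-minor zero (z k) refl) (quad-minor zero M (z k) refl) ⟨
    e k ∎
    where open ≡-Reasoning

  e-null : Null e
  e-null = null-cong e≡ (null-neg (null-· {x = y} {y = λ k i → (minor zero M ⊛ y k) i - q k * y k i} (λ i → cauchy⇒bounded {λ k → y k i} (converge i)) residual))

  m²≤ : ∀ k → 1ℚ * ∣ m k * m k ∣ ≤ ∣ D k * e k ∣
  m²≤ k = subst (_≤ ∣ D k * e k ∣) (sym (trans (ℚ.*-identityˡ ∣ m k * m k ∣) (ℚ.0≤p⇒∣p∣≡p (0≤p*p (m k)))))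
    (ℚ.≤-trans (squared-row≤ {q = q k} M-sym (0<D k) (M⪯q k) (q-M≤D k) (z k) refl) (p≤∣p∣ (D k * e k)))

  D-bounded : Bounded D
  D-bounded = bounded-+ {λ k → ∣ q k ∣} (bounded-∣∣ {q} (cauchy⇒bounded {q} q-cauchy)) (bounded-const (1ℚ + ∣ M zero zero ∣))

  z-residual : ∀ i → Null (λ k → (M ⊛ z k) i - q k * z k i)
  z-residual zero    = null-cong (λ k → solve 2 (λ m q → m := m :- q :* con 0ℚ) refl (m k) (q k))
    (null-sqrt (null-squeeze 0<1 (null-* D-bounded e-null) (0 , λ k _ → m²≤ k)))
  z-residual (suc i) = null-cong (λ k → solve 3 (λ a b c → a :- b := (c :* con 0ℚ :+ a) :- b) refl
    ((minor zero M ⊛ y k) i) (q k * y k i) (M (suc i) zero)) (residual i)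

-- If no l k bounds the form without the first coordinate, then l and u bracket the top eigenvalue of that
-- minor as well; otherwise there is a gap between the two top eigenvalues.
¬¬eigensequence : ∀ (M : ℚMatrix n) → IsSymmetric M → ∀ {l u} → IsCauchy u → Null (λ k → u k - l k) → Brackets l u M →
                  ¬ ¬ (∃[ N ] ∃[ v ] Eigensequence M (λ k → u (N ℕ.+ k)) v)
¬¬eigensequence {zero} M M-sym {l} u-cauchy width-null brackets _ with lower brackets 0
... | x , l<M = ℚ.<-irrefl (ℚ.*-zeroʳ (l 0)) l<M
¬¬eigensequence {suc n} M M-sym {l} {u} u-cauchy width-null brackets ¬es =
  ¬¬eigensequence (minor zero M) minor-sym u-cauchy width-null minor-brackets
    λ (N , v , es) → ¬es (N , suc v , extendByZero M-sym (cauchy-shift N {u} u-cauchy) (λ k → upper brackets (N ℕ.+ k)) es)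
  where
  minor-sym : IsSymmetric (minor zero M)
  minor-sym i j = M-sym (suc i) (suc j)

  gap : ∀ k → minor zero M ⪯ l k → ∃[ N ] ∃[ v ] Eigensequence M (λ k → u (N ℕ.+ k)) v
  gap k M⪯l =
    let x , l<M = lower brackets k
        γ , 0<γ , l+γ<M = exceed-gap M {t = l k} {x = x} l<M
        -- Every upper end is above l k + γ. Half of this gap is spent on the width, so that from N
        -- on the lower ends stay above l k + ½γ too.
        N , w<½γ = width-null (½ * γ) (0<-* 0<½ 0<γ)
        l+½γ≤ : ∀ j → l k + ½ * γ ≤ l (N ℕ.+ j)
        l+½γ≤ j = ≤-by (0≤-+ (p≤q⇒0≤q-p (ℚ.<⇒≤ (exceeds⇒< {p = l k + γ} {q = u (N ℕ.+ j)} M (x , l+γ<M) (upper brackets (N ℕ.+ j)))))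
                             (p≤q⇒0≤q-p (ℚ.≤-trans (p≤∣p∣ (u (N ℕ.+ j) - l (N ℕ.+ j))) (ℚ.<⇒≤ (w<½γ (N ℕ.+ j) (ℕ.m≤m+n N j))))))
          (solve 4 (λ a b g c → b := (a :+ con ½ :* g) :+ ((c :- (a :+ g)) :+ (con ½ :* g :- (c :- b)))) refl (l k) (l (N ℕ.+ j)) γ (u (N ℕ.+ j)))
    in N , zero , eigensequence zero M-sym {t = l k} (0<-* 0<½ 0<γ) M⪯l l+½γ≤ (cauchy-shift N {u} u-cauchy) (null-shift N width-null)
         (record { lower = λ j → lower brackets (N ℕ.+ j) ; upper = λ j → upper brackets (N ℕ.+ j) })

  minor-brackets : Brackets l u (minor zero M)
  minor-brackets = record
    -- Finding some k with a gap would be an unbounded search; the assumption `¬es` excludes a gap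
    -- at every k at once, and `⪯?` turns this into an explicit excess.
    { lower = λ k → [ (λ M⪯l → contradiction (gap k M⪯l) ¬es) , (λ e → e) ]′ (⪯? (minor zero M) minor-sym (l k))
    ; upper = λ k → minor-⪯ M (u k) (upper brackets k)
    }

-- Bisection for the top eigenvalue

sum-≤ : ∀ {f g : Vector ℚ n} {w} → (∀ i → f i ≤ g i * w) → sum f ≤ sum g * w
sum-≤ {zero}  {w = w} f≤g = ℚ.≤-reflexive (sym (ℚ.*-zeroˡ w))
sum-≤ {suc n} {g = g} {w = w} f≤g = ℚ.≤-trans (ℚ.+-mono-≤ (f≤g zero) (sum-≤ (f≤g ∘ suc)))
  (ℚ.≤-reflexive (sym (ℚ.*-distribʳ-+ w (g zero) (sum (g ∘ suc)))))

-- A crude start for the bisection: 2mab ≤ m²a² + b² bounds each term of the form by (m² + 1) |x|²,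
-- with m the matrix entry and a, b the two coordinates.
upperBound : ∀ (M : ℚMatrix n) → ∃[ u ] M ⪯ u
upperBound M = sum (λ i → sum (λ j → M i j * M i j + 1ℚ)) , λ x → sum-≤ λ i →
  subst (_≤ sum (λ j → M i j * M i j + 1ℚ) * (x · x)) (sym (*-distribˡ-sum (x i) (λ j → M i j * x j)))
    (sum-≤ λ j → *-cancelˡ-≤ 0<2 (≤-by
      (0≤-+ (0≤-+ (0≤-+ (0≤p*p (M i j * x i - x j)) (0≤-* (0≤p*p (M i j)) (p≤q⇒0≤q-p (xᵢ*xᵢ≤x·x x i)))) (p≤q⇒0≤q-p (xᵢ*xᵢ≤x·x x j)))
            (0≤-* (0≤-+ (0≤p*p (M i j)) (ℚ.<⇒≤ 0<1)) (0≤x·x x)))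
      (solve 4 (λ m a b w → con 2ℚ :* ((m :* m :+ con 1ℚ) :* w)
           := con 2ℚ :* (a :* (m :* b)) :+ ((m :* a :- b) :* (m :* a :- b) :+ m :* m :* (w :- a :* a) :+ (w :- b :* b) :+ (m :* m :+ con 1ℚ) :* w))
         refl (M i j) (x i) (x j) (x · x))))

module Bisection (M : ℚMatrix n) (M-sym : IsSymmetric M) {l₀ : ℚ} (l₀<M : Exceeds M l₀) where

  record Bracket : Set where
    constructor bracket
    field
      lo hi : ℚ
      lo<M  : Exceeds M lo
      M⪯hi  : M ⪯ hi

  open Bracket

  lo<hi : ∀ b → lo b < hi b
  lo<hi b = exceeds⇒< M (lo<M b) (M⪯hi b)

  record Halved (b : Bracket) : Set where
    field
      half    : Bracket
      lo≤     : lo b ≤ lo half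
      ≤hi     : hi half ≤ hi b
      width-½ : hi half - lo half ≡ ½ * (hi b - lo b)

  open Halved

  halve : ∀ b → Halved b
  halve b = [ lowerHalf , upperHalf ]′ (⪯? M M-sym m)
    where
    m : ℚ
    m = ½ * (lo b + hi b)
    0≤½w : 0ℚ ≤ ½ * (hi b - lo b)
    0≤½w = 0≤-* (ℚ.<⇒≤ 0<½) (p≤q⇒0≤q-p (ℚ.<⇒≤ (lo<hi b)))
    lowerHalf : M ⪯ m → Halved b
    lowerHalf M⪯m = record
      { half    = bracket (lo b) m (lo<M b) M⪯m
      ; lo≤     = ℚ.≤-refl
      ; ≤hi     = ≤-by 0≤½w (solve 2 (λ l h → h := con ½ :* (l :+ h) :+ con ½ :* (h :- l)) refl (lo b) (hi b))
      ; width-½ = solve 2 (λ l h → con ½ :* (l :+ h) :- l := con ½ :* (h :- l)) refl (lo b) (hi b)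
      }
    upperHalf : Exceeds M m → Halved b
    upperHalf m<M = record
      { half    = bracket m (hi b) m<M (M⪯hi b)
      ; lo≤     = ≤-by 0≤½w (solve 2 (λ l h → con ½ :* (l :+ h) := l :+ con ½ :* (h :- l)) refl (lo b) (hi b))
      ; ≤hi     = ℚ.≤-refl
      ; width-½ = solve 2 (λ l h → h :- con ½ :* (l :+ h) := con ½ :* (h :- l)) refl (lo b) (hi b)
      }

  step : ℕ → Bracket
  step zero    = bracket l₀ (proj₁ (upperBound M)) l₀<M (proj₂ (upperBound M))
  step (suc k) = half (halve (step k))

  l u : ℕ → ℚ
  l k = lo (step k)
  u k = hi (step k)

  brackets : Brackets l u M
  brackets = record { lower = λ k → lo<M (step k) ; upper = λ k → M⪯hi (step k) }

  l-mono : ∀ {j k} → j ℕ.≤ k → l j ≤ l k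
  l-mono = monotone {l} (λ k → lo≤ (halve (step k)))

  -u-mono : ∀ {j k} → j ℕ.≤ k → - u j ≤ - u k
  -u-mono = monotone {λ k → - u k} (λ k → ℚ.neg-antimono-≤ (≤hi (halve (step k))))

  l₀≤l : ∀ k → l₀ ≤ l k
  l₀≤l k = l-mono {0} {k} ℕ.z≤n

  0≤width : ∀ k → 0ℚ ≤ u k - l k
  0≤width k = p≤q⇒0≤q-p (ℚ.<⇒≤ (lo<hi (step k)))

  2^k*width : ∀ k → 2^ k * (u k - l k) ≡ u 0 - l 0
  2^k*width zero    = ℚ.*-identityˡ (u 0 - l 0)
  2^k*width (suc k) = trans (cong (2^ suc k *_) (width-½ (halve (step k))))
    (trans (solve 2 (λ t w → (t :+ t) :* (con ½ :* w) := t :* w) refl (2^ k) (u k - l k)) (2^k*width k))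

  -- Take N at least (u 0 - l 0)/ε. Since N < 2^N, halving the initial width N times brings it below
  -- ε.
  width-small : ∀ ε → 0ℚ < ε → ∃[ N ] u N - l N < ε
  width-small ε 0<ε =
    let d , 0<d , εd≡1 = reciprocal 0<ε
        N , dw≤N = archimedean (d * (u 0 - l 0))
        0<2^N = ℚ.<-≤-trans 0<1 (1≤2^ N)
    in N , *-cancelˡ-< 0<2^N (ℚ.≤-<-trans
         (ℚ.≤-trans (ℚ.≤-reflexive (trans (2^k*width N) (sym (trans (sym (ℚ.*-assoc ε d (u 0 - l 0)))
           (trans (cong (_* (u 0 - l 0)) εd≡1) (ℚ.*-identityˡ (u 0 - l 0))))))) (*-monoˡ-≤ (ℚ.<⇒≤ 0<ε) dw≤N))
         (subst (ε * fromℕ N <_) (ℚ.*-comm ε (2^ N)) (*-monoˡ-< 0<ε (fromℕ<2^ N))))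

  width-null : Null (λ k → u k - l k)
  width-null ε 0<ε = let N , w<ε = width-small ε 0<ε in
    N , λ k N≤k → ℚ.≤-<-trans (ℚ.≤-reflexive (ℚ.0≤p⇒∣p∣≡p (0≤width k)))
      (ℚ.≤-<-trans (≤-by (0≤-+ (p≤q⇒0≤q-p (l-mono N≤k)) (p≤q⇒0≤q-p (-u-mono N≤k)))
        (solve 4 (λ u v l m → u :- l := (v :- m) :+ ((m :- l) :+ (:- v :- :- u))) refl (u N) (u k) (l N) (l k))) w<ε)

  u-cauchy : IsCauchy u
  u-cauchy ε 0<ε = let N , w<ε = width-small ε 0<ε in
    N , λ j k N≤j N≤k → ℚ.≤-<-trans (∣p∣≤ (u-diff N≤j N≤k)
      (subst (_≤ u N - l N) (solve 2 (λ a b → a :- b := :- (b :- a)) refl (u k) (u j)) (u-diff N≤k N≤j))) w<ε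
    where
    u-diff : ∀ {N j k} → N ℕ.≤ j → N ℕ.≤ k → u j - u k ≤ u N - l N
    u-diff {N} {j} {k} N≤j N≤k = ≤-by (0≤-+ (0≤-+ (p≤q⇒0≤q-p (-u-mono N≤j)) (p≤q⇒0≤q-p (l-mono N≤k))) (0≤width k))
      (solve 5 (λ N L j k m → N :- L := (j :- k) :+ ((:- j :- :- N) :+ (m :- L) :+ (k :- m))) refl (u N) (l N) (u j) (u k) (l k))

-- Uniqueness of the eigenvalue above the bound of a minor

-- Pairing the residual with z gives quad M z - ν |z|², which is eventually at most -γ |z|². As the
-- residual is null and z bounded, |z|² tends to 0.
norm-null : ∀ (M : ℚMatrix n) {t γ} (z : ℕ → Vector ℚ n) (ν : ℕ → ℚ) → 0ℚ < γ → (∃[ N ] ∀ k → N ℕ.≤ k → t + γ ≤ ν k) →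
            (∀ k → quad M (z k) ≤ t * (z k · z k)) → (∀ i → Bounded (λ k → z k i)) →
            (∀ i → Null (λ k → (M ⊛ z k) i - ν k * z k i)) → Null (λ k → z k · z k)
norm-null M {t} {γ} z ν 0<γ (N , t+γ≤ν) M≤t z-bdd residual = null-squeeze 0<γ (null-neg z·ξ-null) (N , bound)
  where
  ξ : ℕ → Vector ℚ _
  ξ k i = (M ⊛ z k) i - ν k * z k i

  z·ξ-null : Null (λ k → z k · ξ k)
  z·ξ-null = null-· {x = z} {y = ξ} z-bdd residual

  z·ξ : ∀ k → z k · ξ k ≡ quad M (z k) - ν k * (z k · z k)
  z·ξ k = trans (·-congʳ (z k) (λ i → solve 3 (λ a b c → a :- b :* c := a :+ (:- b) :* c) refl ((M ⊛ z k) i) (ν k) (z k i)))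
    (trans (·-combʳ (z k) (M ⊛ z k) (- ν k) (z k))
      (solve 3 (λ a b c → a :+ (:- b) :* c := a :- b :* c) refl (quad M (z k)) (ν k) (z k · z k)))

  bound : ∀ k → N ℕ.≤ k → γ * ∣ z k · z k ∣ ≤ ∣ - (z k · ξ k) ∣
  bound k N≤k = subst (λ a → γ * a ≤ ∣ - (z k · ξ k) ∣) (sym (ℚ.0≤p⇒∣p∣≡p (0≤x·x (z k)))) (ℚ.≤-trans
    (≤-by (0≤-+ (p≤q⇒0≤q-p (M≤t k)) (0≤-* (p≤q⇒0≤q-p (t+γ≤ν k N≤k)) (0≤x·x (z k))))
      (trans (cong -_ (z·ξ k)) (solve 5 (λ g Z t v Q → :- (Q :- v :* Z) := g :* Z :+ (t :* Z :- Q :+ (v :- (t :+ g)) :* Z))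
        refl γ (z k · z k) t (ν k) (quad M (z k)))))
    (p≤∣p∣ (- (z k · ξ k))))

module TopEigenvalue {v : Fin (suc n)} {M : ℚMatrix (suc n)} (M-sym : IsSymmetric M) {t γ : ℚ} (0<γ : 0ℚ < γ) (M⪯t : minor v M ⪯ t)
  {q : ℕ → ℚ} (q-cauchy : IsCauchy q) (t+γ≤q : ∀ k → t + γ ≤ q k) (es : Eigensequence M q v)
  {y : ℕ → Vector ℚ (suc n)} (y-bdd : ∀ i → Bounded (λ k → y k i)) {μ : ℕ → ℚ} (μ-bdd : Bounded μ)
  (y-residual : ∀ i → Null (λ k → (M ⊛ y k) i - μ k * y k i))
  where

  open Eigensequence es renaming (vec to x; residual to x-residual)

  x-bdd : ∀ i → Bounded (λ k → x k i)
  x-bdd i = cauchy⇒bounded {λ k → x k i} (converge i)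

  c : ℕ → ℚ
  c k = y k v

  z : ℕ → Vector ℚ (suc n)
  z k = y k +[ - c k ] x k

  zᵥ≡0 : ∀ k → z k v ≡ 0ℚ
  zᵥ≡0 k = trans (cong (λ a → c k + (- c k) * a) (pivot k)) (solve 1 (λ c → c :+ (:- c) :* con 1ℚ := con 0ℚ) refl (c k))

  quad-z≤ : ∀ k → quad M (z k) ≤ t * (z k · z k)
  quad-z≤ k = off-minor M-sym t M⪯t (z k) (zᵥ≡0 k)

  -- For equal eigenvalues z is an approximate eigenvector too; it vanishes at v, so the bound of
  -- the minor and `norm-null` make it null.
  same⇒proportional : (∀ k → μ k ≡ q k) → ∀ i → Null (λ k → y k i - c k * x k i)
  same⇒proportional μ≡q i = null-cong (λ k → solve 3 (λ a c b → a :+ (:- c) :* b := a :- c :* b) refl (y k i) (c k) (x k i))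
    (null-norm⇒null {x = z} (norm-null M {t = t} z q 0<γ (0 , λ k _ → t+γ≤q k) quad-z≤ z-bdd z-residual) i)
    where
    -c-bdd : Bounded (λ k → - c k)
    -c-bdd = let B , 0<B , N , c≤B = y-bdd v in B , 0<B , N , λ k N≤k → subst (_≤ B) (sym (ℚ.∣-p∣≡∣p∣ (c k))) (c≤B k N≤k)

    z-bdd : ∀ i → Bounded (λ k → z k i)
    z-bdd i = bounded-+ {λ k → y k i} (y-bdd i) (bounded-* {λ k → - c k} -c-bdd (x-bdd i))

    z-residual : ∀ i → Null (λ k → (M ⊛ z k) i - q k * z k i)
    z-residual i = null-cong (λ k → begin
        ((M ⊛ y k) i - μ k * y k i) + (- c k) * ((M ⊛ x k) i - q k * x k i)
          ≡⟨ cong (λ a → ((M ⊛ y k) i - a * y k i) + (- c k) * ((M ⊛ x k) i - q k * x k i)) (μ≡q k) ⟩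
        ((M ⊛ y k) i - q k * y k i) + (- c k) * ((M ⊛ x k) i - q k * x k i)
          ≡⟨ solve 6 (λ a q y c b x → (a :- q :* y) :+ (:- c) :* (b :- q :* x) := (a :+ (:- c) :* b) :- q :* (y :+ (:- c) :* x))
               refl ((M ⊛ y k) i) (q k) (y k i) (c k) ((M ⊛ x k) i) (x k i) ⟩
        ((M ⊛ y k) i + (- c k) * (M ⊛ x k) i) - q k * z k i
          ≡⟨ cong (_- q k * z k i) (·-combʳ (M i) (y k) (- c k) (x k)) ⟨
        (M ⊛ z k) i - q k * z k i ∎)
      (null-+ (y-residual i) (null-* -c-bdd (x-residual i)))
      where open ≡-Reasoning

  -- Eigenvectors for separated eigenvalues are asymptotically orthogonal: (μ - q)(x · y) is a
  -- difference of residual terms. Up to null terms, t |z|² - quad M z is then (t - μ) |y|² + c² (t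
  -- - q) |x|². The minor makes this expression nonnegative although both coefficients are negative,
  -- which forces y to 0.
  distinct⇒null : ∀ {η} → 0ℚ < η → (∃[ N ] ∀ k → N ℕ.≤ k → η ≤ ∣ μ k - q k ∣) → (∃[ γ′ ] 0ℚ < γ′ × ∃[ N ] ∀ k → N ℕ.≤ k → t + γ′ ≤ μ k) →
                  Null (λ k → y k · y k)
  distinct⇒null {η} 0<η (K , η≤μ-q) (γ′ , 0<γ′ , N , t+γ′≤μ) = null-squeeze 0<γ′ e-null (N , bound)
    where
    ξ s : ℕ → Vector ℚ (suc n)
    ξ k i = (M ⊛ x k) i - q k * x k i
    s k i = (M ⊛ y k) i - μ k * y k i

    apply-residual : ∀ (w x : Vector ℚ (suc n)) q → w · M ⊛ x ≡ q * (w · x) + w · (λ i → (M ⊛ x) i - q * x i)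
    apply-residual w x q = begin
      w · M ⊛ x
        ≡⟨ ·-congʳ w (λ i → solve 2 (λ a b → a := (a :- b) :+ con 1ℚ :* b) refl ((M ⊛ x) i) (q * x i)) ⟩
      w · ((λ i → (M ⊛ x) i - q * x i) +[ 1ℚ ] (λ i → q * x i))
        ≡⟨ ·-combʳ w (λ i → (M ⊛ x) i - q * x i) 1ℚ (λ i → q * x i) ⟩
      ρ + 1ℚ * (w · (λ i → q * x i))
        ≡⟨ cong (λ a → ρ + 1ℚ * a) (trans (·-congʳ w (λ i → sym (ℚ.+-identityˡ (q * x i))))
             (trans (·-combʳ w (λ _ → 0ℚ) q x) (cong (_+ q * (w · x)) (·-zeroʳ w (λ _ → refl))))) ⟩
      ρ + 1ℚ * (0ℚ + q * (w · x))
        ≡⟨ solve 2 (λ a b → a :+ con 1ℚ :* (con 0ℚ :+ b) := b :+ a) refl ρ (q * (w · x)) ⟩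
      q * (w · x) + ρ ∎
      where
      open ≡-Reasoning
      ρ : ℚ
      ρ = w · (λ i → (M ⊛ x) i - q * x i)

    x·ξ-null : Null (λ k → x k · ξ k)
    x·ξ-null = null-· {x = x} {y = ξ} x-bdd x-residual
    y·ξ-null : Null (λ k → y k · ξ k)
    y·ξ-null = null-· {x = y} {y = ξ} y-bdd x-residual
    x·s-null : Null (λ k → x k · s k)
    x·s-null = null-· {x = x} {y = s} x-bdd y-residual
    y·s-null : Null (λ k → y k · s k)
    y·s-null = null-· {x = y} {y = s} y-bdd y-residual

    [μ-q]x·y : ∀ k → y k · ξ k - x k · s k ≡ (μ k - q k) * (x k · y k)
    [μ-q]x·y k = begin
      y k · ξ k - x k · s k
        ≡⟨ solve 4 (λ a b c d → a :- b := ((c :+ a) :- (d :+ b)) :+ (d :- c)) refl (y k · ξ k) (x k · s k) (q k * (y k · x k)) (μ k * (x k · y k)) ⟩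
      ((q k * (y k · x k) + y k · ξ k) - (μ k * (x k · y k) + x k · s k)) + (μ k * (x k · y k) - q k * (y k · x k))
        ≡⟨ cong₂ (λ a b → (a - b) + (μ k * (x k · y k) - q k * (y k · x k))) (sym (apply-residual (y k) (x k) (q k))) (sym (apply-residual (x k) (y k) (μ k))) ⟩
      (y k · M ⊛ x k - x k · M ⊛ y k) + (μ k * (x k · y k) - q k * (y k · x k))
        ≡⟨ cong₂ (λ a b → (a - x k · M ⊛ y k) + (μ k * (x k · y k) - q k * b)) (·-⊛-sym M-sym (y k) (x k)) (·-comm (y k) (x k)) ⟩
      (x k · M ⊛ y k - x k · M ⊛ y k) + (μ k * (x k · y k) - q k * (x k · y k))
        ≡⟨ solve 4 (λ a m q b → (a :- a) :+ (m :* b :- q :* b) := (m :- q) :* b) refl (x k · M ⊛ y k) (μ k) (q k) (x k · y k) ⟩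
      (μ k - q k) * (x k · y k) ∎
      where open ≡-Reasoning

    x·y-null : Null (λ k → x k · y k)
    x·y-null = null-squeeze {s = λ k → x k · y k} 0<η (null-cong [μ-q]x·y (null-- y·ξ-null x·s-null)) (K , λ k K≤k →
      subst₂ _≤_ (ℚ.*-comm ∣ x k · y k ∣ η) (trans (ℚ.*-comm ∣ x k · y k ∣ ∣ μ k - q k ∣) (sym (ℚ.∣p*q∣≡∣p∣*∣q∣ (μ k - q k) (x k · y k))))
        (*-monoˡ-≤ (ℚ.0≤∣p∣ (x k · y k)) (η≤μ-q k K≤k)))

    -- What remains of t |z|² - quad M z without (t - μ) |y|² and c² (t - q) |x|²: cross terms and
    -- residuals only.
    e : ℕ → ℚ
    e k = 2ℚ * c k * (μ k * (x k · y k) + x k · s k) - 2ℚ * t * c k * (x k · y k) - y k · s k - c k * c k * (x k · ξ k)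

    c-bdd : Bounded c
    c-bdd = y-bdd v

    e-null : Null e
    e-null = null-- (null-- (null--
      (null-* {λ k → 2ℚ * c k} (bounded-* (bounded-const 2ℚ) c-bdd) (null-+ (null-* μ-bdd x·y-null) x·s-null))
      (null-* {λ k → 2ℚ * t * c k} (bounded-* (bounded-const (2ℚ * t)) c-bdd) x·y-null))
      y·s-null) (null-* (bounded-* c-bdd c-bdd) x·ξ-null)

    quad-z : ∀ k → quad M (z k) ≡ (μ k * (y k · y k) + y k · s k) + 2ℚ * (- c k) * (μ k * (x k · y k) + x k · s k)
                                  + (- c k) * (- c k) * (q k * (x k · x k) + x k · ξ k)
    quad-z k = trans (quad-comb M-sym (y k) (- c k) (x k)) (cong₂ _+_
      (cong₂ (λ a b → a + 2ℚ * (- c k) * b) (apply-residual (y k) (y k) (μ k)) (apply-residual (x k) (y k) (μ k)))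
      (cong ((- c k) * (- c k) *_) (apply-residual (x k) (x k) (q k))))

    z·z : ∀ k → z k · z k ≡ y k · y k + 2ℚ * (- c k) * (x k · y k) + (- c k) * (- c k) * (x k · x k)
    z·z k = trans (·-square-comb (y k) (- c k) (x k))
      (cong (λ a → y k · y k + 2ℚ * (- c k) * a + (- c k) * (- c k) * (x k · x k)) (·-comm (y k) (x k)))

    bound : ∀ k → N ℕ.≤ k → γ′ * ∣ y k · y k ∣ ≤ ∣ e k ∣
    bound k N≤k = subst (λ a → γ′ * a ≤ ∣ e k ∣) (sym (ℚ.0≤p⇒∣p∣≡p (0≤x·x (y k)))) (ℚ.≤-trans
      (≤-by (0≤-+ (0≤-+ (p≤q⇒0≤q-p (quad-z≤ k)) (0≤-* (p≤q⇒0≤q-p (t+γ′≤μ k N≤k)) (0≤x·x (y k))))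
                  (0≤-* (0≤-* (p≤q⇒0≤q-p (ℚ.≤-trans (≤-by {q = t + γ} {p = t} (ℚ.<⇒≤ 0<γ) refl) (t+γ≤q k))) (0≤p*p (c k))) (0≤x·x (x k))))
        (sym (begin
          γ′ * Y + ((t * (z k · z k) - quad M (z k)) + (μ k - (t + γ′)) * Y + (q k - t) * (c k * c k) * X)
            ≡⟨ cong₂ (λ a b → γ′ * Y + ((t * a - b) + (μ k - (t + γ′)) * Y + (q k - t) * (c k * c k) * X)) (z·z k) (quad-z k) ⟩
          γ′ * Y + ((t * (Y + 2ℚ * (- c k) * B + (- c k) * (- c k) * X) - ((μ k * Y + S) + 2ℚ * (- c k) * (μ k * B + T) + (- c k) * (- c k) * (q k * X + R)))
                    + (μ k - (t + γ′)) * Y + (q k - t) * (c k * c k) * X)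
            ≡⟨ rearrange γ′ t (c k) (μ k) (q k) Y B X S T R ⟩
          e k ∎)))
      (p≤∣p∣ (e k)))
      where
      open ≡-Reasoning
      Y B X S T R : ℚ
      Y = y k · y k
      B = x k · y k
      X = x k · x k
      S = y k · s k
      T = x k · s k
      R = x k · ξ k
      rearrange : ∀ g t c m q Y B X S T R →
        g * Y + ((t * (Y + 2ℚ * (- c) * B + (- c) * (- c) * X) - ((m * Y + S) + 2ℚ * (- c) * (m * B + T) + (- c) * (- c) * (q * X + R)))
                 + (m - (t + g)) * Y + (q - t) * (c * c) * X)
        ≡ 2ℚ * c * (m * B + T) - 2ℚ * t * c * B - S - c * c * R
      rearrange = solve 11 (λ g t c m q Y B X S T R →
        g :* Y :+ ((t :* (Y :+ con 2ℚ :* (:- c) :* B :+ (:- c) :* (:- c) :* X) :- ((m :* Y :+ S) :+ con 2ℚ :* (:- c) :* (m :* B :+ T) :+ (:- c) :* (:- c) :* (q :* X :+ R)))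
                 :+ (m :- (t :+ g)) :* Y :+ (q :- t) :* (c :* c) :* X)
        := con 2ℚ :* c :* (m :* B :+ T) :- con 2ℚ :* t :* c :* B :- S :- c :* c :* R) refl

-- Real eigenvectors as sequences of rational vectors

seqs : Vector ℝ n → ℕ → Vector ℚ n
seqs x k i = seq (x i) k

seqs-bounded : ∀ (x : Vector ℝ n) i → Bounded (λ k → seqs x k i)
seqs-bounded x i = cauchy⇒bounded {seq (x i)} (cauchy (x i))

seq-sum : ∀ (x : Vector ℝ n) k → seq (ℝ.sum x) k ≡ sum (seqs x k)
seq-sum {zero}  x k = refl
seq-sum {suc n} x k = cong (seq (x zero) k +_) (seq-sum (x ∘ suc) k)

adjacency : Graph (Fin n) → ℚMatrix n
adjacency G i j = if does (Graph._~?_ G i j) then 1ℚ else 0ℚ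

seq-adjacency : ∀ (G : Graph (Fin n)) i j k → seq (adjacencyMatrix G i j) k ≡ adjacency G i j
seq-adjacency G i j k with does (Graph._~?_ G i j)
... | true  = refl
... | false = refl

adjacency-~ : ∀ (G : Graph (Fin n)) {i j} → Graph._~_ G i j → adjacency G i j ≡ 1ℚ
adjacency-~ G {i} {j} i~j = cong (if_then 1ℚ else 0ℚ) (dec-true (Graph._~?_ G i j) i~j)

adjacency-≁ : ∀ (G : Graph (Fin n)) {i j} → ¬ Graph._~_ G i j → adjacency G i j ≡ 0ℚ
adjacency-≁ G {i} {j} i≁j = cong (if_then 1ℚ else 0ℚ) (dec-false (Graph._~?_ G i j) i≁j)

adjacency-sym : ∀ (G : Graph (Fin n)) → IsSymmetric (adjacency G)
adjacency-sym G i j = bySymmetry (Graph._~?_ G i j)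
  where
  bySymmetry : Dec (Graph._~_ G i j) → adjacency G i j ≡ adjacency G j i
  bySymmetry (yes i~j) = trans (adjacency-~ G i~j) (sym (adjacency-~ G (Graph.~-sym G i~j)))
  bySymmetry (no i≁j)  = trans (adjacency-≁ G i≁j) (sym (adjacency-≁ G (i≁j ∘ Graph.~-sym G)))

seq-*ᵥ : ∀ (G : Graph (Fin n)) (x : Vector ℝ n) i k → seq ((adjacencyMatrix G *ᵥ x) i) k ≡ (adjacency G ⊛ seqs x k) i
seq-*ᵥ G x i k = trans (seq-sum (λ j → adjacencyMatrix G i j ℝ.* x j) k)
  (sum-cong-≗ (λ j → cong (_* seq (x j) k) (seq-adjacency G i j k)))

-- `_≈_` unfolds to nullness of the difference of the sequences, so only the row sums have to be
-- rewritten.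
residual-null : ∀ (G : Graph (Fin n)) (μ : ℝ) (x : Vector ℝ n) → (∀ i → (adjacencyMatrix G *ᵥ x) i ≈ μ ℝ.* x i) →
                ∀ i → Null (λ k → (adjacency G ⊛ seqs x k) i - seq μ k * seqs x k i)
residual-null G μ x Ax≈μx i = null-cong (λ k → cong (_- seq μ k * seqs x k i) (seq-*ᵥ G x i k)) (Ax≈μx i)

apart⇒¬null : ∀ {x : ℝ} → x # 0ℝ → ¬ Null (seq x)
apart⇒¬null {x} (inj₁ (ε , 0<ε , N , x+ε≤0)) x-null = let K , x<ε = x-null ε 0<ε; k = N ℕ.⊔ K in
  ≤⇒≯ (ℚ.≤-trans (≤-by (p≤q⇒0≤q-p (x+ε≤0 k (ℕ.m≤m⊔n N K))) (solve 2 (λ x e → :- x := e :+ (con 0ℚ :- (x :+ e))) refl (seq x k) ε)) (-p≤∣p∣ (seq x k)))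
    (x<ε k (ℕ.m≤n⊔m N K))
apart⇒¬null {x} (inj₂ (ε , 0<ε , N , ε≤x)) x-null = let K , x<ε = x-null ε 0<ε; k = N ℕ.⊔ K in
  ≤⇒≯ (ℚ.≤-trans (subst (_≤ seq x k) (ℚ.+-identityˡ ε) (ε≤x k (ℕ.m≤m⊔n N K))) (p≤∣p∣ (seq x k))) (x<ε k (ℕ.m≤n⊔m N K))

-- With e = ε/8, both sequences stay within e of their terms at N. One rational comparison at N then
-- suffices: a distance below 4e stays below 6e < ε afterwards, and a distance of at least 4e leaves
-- a separation of at least 2e, which is apartness.
≈-tight : ∀ {x y : ℝ} → ¬ x # y → x ≈ y
≈-tight {x} {y} ¬x#y ε 0<ε = byDistance (∣ x₀ - y₀ ∣ ℚ.<? 4e)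
  where
  e 4e : ℚ
  e = ½ * (½ * (½ * ε))
  4e = 2ℚ * (2ℚ * e)

  0<e : 0ℚ < e
  0<e = 0<-* 0<½ (0<-* 0<½ (0<-* 0<½ 0<ε))

  Nx Ny N : ℕ
  Nx = proj₁ (cauchy x e 0<e)
  Ny = proj₁ (cauchy y e 0<e)
  N  = Nx ℕ.⊔ Ny

  x₀ y₀ : ℚ
  x₀ = seq x N
  y₀ = seq y N

  x-close : ∀ k → N ℕ.≤ k → ∣ seq x k - x₀ ∣ ≤ e
  x-close k N≤k = ℚ.<⇒≤ (proj₂ (cauchy x e 0<e) k N (ℕ.m⊔n≤o⇒m≤o Nx Ny N≤k) (ℕ.m≤m⊔n Nx Ny))

  y-close : ∀ k → N ℕ.≤ k → ∣ y₀ - seq y k ∣ ≤ e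
  y-close k N≤k = ℚ.<⇒≤ (proj₂ (cauchy y e 0<e) N k (ℕ.m≤n⊔m Nx Ny) (ℕ.m⊔n≤o⇒n≤o Nx Ny N≤k))

  Close : Set
  Close = ∃[ N ] ∀ k → N ℕ.≤ k → ∣ seq x k - seq y k ∣ < ε

  farApart : ∀ (d : ℚ) → d ≡ x₀ - y₀ ⊎ d ≡ y₀ - x₀ → 4e ≤ d → x # y
  farApart d (inj₁ refl) 4e≤d = inj₂ (2ℚ * e , 0<-* 0<2 0<e , N , λ k N≤k → ≤-by
    (0≤-+ (0≤-+ (p≤q⇒0≤q-p 4e≤d) (p≤q⇒0≤q-p (ℚ.≤-trans (-p≤∣p∣ (seq x k - x₀)) (x-close k N≤k)))) (p≤q⇒0≤q-p (ℚ.≤-trans (-p≤∣p∣ (y₀ - seq y k)) (y-close k N≤k))))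
    (solve 5 (λ a b c d e → c := (d :+ con 2ℚ :* e) :+ ((a :- b :- con 2ℚ :* (con 2ℚ :* e)) :+ (e :- :- (c :- a)) :+ (e :- :- (b :- d))))
      refl x₀ y₀ (seq x k) (seq y k) e))
  farApart d (inj₂ refl) 4e≤d = inj₁ (2ℚ * e , 0<-* 0<2 0<e , N , λ k N≤k → ≤-by
    (0≤-+ (0≤-+ (p≤q⇒0≤q-p 4e≤d) (p≤q⇒0≤q-p (ℚ.≤-trans (p≤∣p∣ (seq x k - x₀)) (x-close k N≤k)))) (p≤q⇒0≤q-p (ℚ.≤-trans (p≤∣p∣ (y₀ - seq y k)) (y-close k N≤k))))
    (solve 5 (λ a b c d e → d := (c :+ con 2ℚ :* e) :+ ((b :- a :- con 2ℚ :* (con 2ℚ :* e)) :+ (e :- (c :- a)) :+ (e :- (b :- d))))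
      refl x₀ y₀ (seq x k) (seq y k) e))

  byDistance : Dec (∣ x₀ - y₀ ∣ < 4e) → Close
  byDistance (yes near) = N , λ k N≤k → subst₂ _<_
    (cong ∣_∣ (solve 4 (λ a b c d → (c :- a) :+ ((a :- b) :+ (b :- d)) := c :- d) refl x₀ y₀ (seq x k) (seq y k))) refl
    (ℚ.≤-<-trans (ℚ.∣p+q∣≤∣p∣+∣q∣ (seq x k - x₀) ((x₀ - y₀) + (y₀ - seq y k)))
    (ℚ.≤-<-trans (ℚ.+-monoʳ-≤ ∣ seq x k - x₀ ∣ (ℚ.∣p+q∣≤∣p∣+∣q∣ (x₀ - y₀) (y₀ - seq y k)))
    (ℚ.≤-<-trans (ℚ.+-mono-≤ (x-close k N≤k) (ℚ.+-mono-≤ (ℚ.<⇒≤ near) (y-close k N≤k)))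
      (<-by (0<-* 0<2 0<e) (solve 1 (λ ε → let e = con ½ :* (con ½ :* (con ½ :* ε)) in
         ε := (e :+ (con 2ℚ :* (con 2ℚ :* e) :+ e)) :+ con 2ℚ :* e) refl ε)))))
  byDistance (no far) = contradiction (bySign (ℚ.∣p∣≡p∨∣p∣≡-p (x₀ - y₀))) ¬x#y
    where
    bySign : ∣ x₀ - y₀ ∣ ≡ x₀ - y₀ ⊎ ∣ x₀ - y₀ ∣ ≡ - (x₀ - y₀) → x # y
    bySign (inj₁ eq) = farApart (x₀ - y₀) (inj₁ refl) (subst (4e ≤_) eq (ℚ.≮⇒≥ far))
    bySign (inj₂ eq) = farApart (y₀ - x₀) (inj₂ refl)
      (subst (4e ≤_) (trans eq (solve 2 (λ a b → :- (a :- b) := b :- a) refl x₀ y₀)) (ℚ.≮⇒≥ far))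

#⇒eventually-apart : ∀ {x y : ℝ} → x # y → ∃[ η ] 0ℚ < η × ∃[ N ] ∀ k → N ℕ.≤ k → η ≤ ∣ seq x k - seq y k ∣
#⇒eventually-apart {x} {y} (inj₁ (η , 0<η , N , x+η≤y)) = η , 0<η , N , λ k N≤k → ℚ.≤-trans
  (≤-by (p≤q⇒0≤q-p (x+η≤y k N≤k)) (solve 3 (λ x y e → :- (x :- y) := e :+ (y :- (x :+ e))) refl (seq x k) (seq y k) η)) (-p≤∣p∣ (seq x k - seq y k))
#⇒eventually-apart {x} {y} (inj₂ (η , 0<η , N , y+η≤x)) = η , 0<η , N , λ k N≤k → ℚ.≤-trans
  (≤-by (p≤q⇒0≤q-p (y+η≤x k N≤k)) (solve 3 (λ x y e → x :- y := e :+ (x :- (y :+ e))) refl (seq x k) (seq y k) η)) (p≤∣p∣ (seq x k - seq y k))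

-- The eigenvalue is a bare rational sequence so that the lemma serves both A with μ and -A with -μ.
⪯⇒noLargerEigenvalue : ∀ (M : ℚMatrix n) t → M ⪯ t → ∀ (x : Vector ℝ n) {ν : ℕ → ℚ} → (∃[ i ] x i # 0ℝ) →
                       (∀ i → Null (λ k → (M ⊛ seqs x k) i - ν k * seqs x k i)) →
                       ¬ (∃[ γ ] 0ℚ < γ × ∃[ N ] ∀ k → N ℕ.≤ k → t + γ ≤ ν k)
⪯⇒noLargerEigenvalue M t M⪯t x {ν} (i , xᵢ#0) residual (γ , 0<γ , t+γ≤ν) = apart⇒¬null {x i} xᵢ#0
  (null-norm⇒null {x = seqs x} (norm-null M {t = t} (seqs x) ν 0<γ t+γ≤ν (λ k → M⪯t (seqs x k)) (seqs-bounded x) residual) i)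

⪯⇒eigenvalue≤ : ∀ (G : Graph (Fin n)) t → adjacency G ⪯ t → ∀ μ → Eigenvalue (adjacencyMatrix G) μ → μ ℝ.≤ fromℚ t
⪯⇒eigenvalue≤ G t A⪯t μ (x , x#0 , Ax≈μx) = ⪯⇒noLargerEigenvalue (adjacency G) t A⪯t x {seq μ} x#0 (residual-null G μ x Ax≈μx)

-2≤eigenvalue : ∀ (G : Graph (Fin n)) → neg (adjacency G) ⪯ 2ℚ → ∀ μ → Eigenvalue (adjacencyMatrix G) μ → -2ℝ ℝ.≤ μ
-2≤eigenvalue G -A⪯2 μ (x , x#0 , Ax≈μx) (ε , 0<ε , N , μ+ε≤-2) =
  ⪯⇒noLargerEigenvalue (neg (adjacency G)) 2ℚ -A⪯2 x {λ k → - seq μ k} x#0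
    (λ i → null-cong (λ k → trans
        (solve 3 (λ a m x → :- (a :- m :* x) := :- a :- (:- m) :* x) refl ((adjacency G ⊛ seqs x k) i) (seq μ k) (seqs x k i))
        (cong (_- (- seq μ k) * seqs x k i) (sym (·-negˡ (adjacency G i) (seqs x k)))))
      (null-neg (residual-null G μ x Ax≈μx i)))
    (ε , 0<ε , N , λ k N≤k → ≤-by (p≤q⇒0≤q-p (μ+ε≤-2 k N≤k))
      (solve 2 (λ m e → :- m := (con 2ℚ :+ e) :+ (con (- 2ℚ) :- (m :+ e))) refl (seq μ k) ε))

eigenpair : ∀ (G : Graph (Fin n)) {q v} (q-cauchy : IsCauchy q) (es : Eigensequence (adjacency G) q v) →
            Eigenvector (adjacencyMatrix G) (mkℝ q q-cauchy) (λ i → mkℝ (λ k → Eigensequence.vec es k i) (Eigensequence.converge es i))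
eigenpair G {q} {v} q-cauchy es =
  (v , inj₂ (1ℚ , 0<1 , 0 , λ k _ → ℚ.≤-reflexive (sym (pivot k)))) ,
  λ i → null-cong (λ k → cong (_- q k * vec k i) (sym (seq-*ᵥ G x i k))) (residual i)
  where
  open Eigensequence es
  x : Vector ℝ _
  x i = mkℝ (λ k → vec k i) (converge i)

eigenvalue : ∀ (G : Graph (Fin n)) {q v} (q-cauchy : IsCauchy q) → Eigensequence (adjacency G) q v →
             Eigenvalue (adjacencyMatrix G) (mkℝ q q-cauchy)
eigenvalue G q-cauchy es = (λ i → mkℝ (λ k → Eigensequence.vec es k i) (Eigensequence.converge es i)) , eigenpair G q-cauchy es

module _ (G : Graph (Fin n)) {t γ : ℚ} (0<γ : 0ℚ < γ) (t+γ<A : Exceeds (adjacency G) (t + γ)) where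

  open Bisection (adjacency G) (adjacency-sym G) {t + γ} t+γ<A

  t+γ≤u : ∀ k → t + γ ≤ u k
  t+γ≤u k = ℚ.≤-trans (l₀≤l k) (ℚ.<⇒≤ (exceeds⇒< (adjacency G) (lower brackets k) (upper brackets k)))

  ¬¬eigenvalue> : ¬ ¬ (∃[ μ ] fromℚ t ℝ.< μ × Eigenvalue (adjacencyMatrix G) μ)
  ¬¬eigenvalue> ¬ev = ¬¬eigensequence (adjacency G) (adjacency-sym G) {l} {u} u-cauchy width-null brackets λ (N , v , es) →
    ¬ev (mkℝ (λ k → u (N ℕ.+ k)) (cauchy-shift N {u} u-cauchy) , (γ , 0<γ , 0 , λ k _ → t+γ≤u (N ℕ.+ k)) , eigenvalue G (cauchy-shift N {u} u-cauchy) es)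

-- By `⪯?` only an excess over 2 has to be refuted. For a refutation the eigenvalue above 2 is
-- needed only up to double negation.
cyclotomic⇒⪯2 : ∀ (G : Graph (Fin n)) → Cyclotomic G → adjacency G ⪯ 2ℚ
cyclotomic⇒⪯2 {n} G cyclotomic = [ (λ A⪯2 → A⪯2) , (λ 2<A → contradiction 2<A ¬exceeds) ]′ (⪯? (adjacency G) (adjacency-sym G) 2ℚ)
  where
  ¬exceeds : ¬ Exceeds (adjacency G) 2ℚ
  ¬exceeds (x , 2<A) = let γ , 0<γ , 2+γ<A = exceed-gap (adjacency G) {t = 2ℚ} {x = x} 2<A in
    ¬¬eigenvalue> G {2ℚ} {γ} 0<γ (x , 2+γ<A) λ (μ , 2<μ , ev) → proj₂ (cyclotomic μ ev) 2<μ

-- Line graphs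

module _ {m} {H : Graph (Fin m)} where

  incidence : Edge H → Vector ℚ m
  incidence e = δ (Edge.lo e) +[ 1ℚ ] δ (Edge.hi e)

  lo≢hi : ∀ (e : Edge H) → Edge.lo e ≢ Edge.hi e
  lo≢hi (edge a b a<b _) = Fin.<⇒≢ (recompute (a Fin.<? b) a<b)

  incidence-· : ∀ (e f : Edge H) → incidence e · incidence f ≡
    (δ (Edge.lo f) (Edge.lo e) + 1ℚ * δ (Edge.hi f) (Edge.lo e)) + 1ℚ * (δ (Edge.lo f) (Edge.hi e) + 1ℚ * δ (Edge.hi f) (Edge.hi e))
  incidence-· e f = trans (·-combˡ (δ (Edge.lo e)) 1ℚ (δ (Edge.hi e)) (incidence f))
    (cong₂ (λ a b → a + 1ℚ * b) (δ-· (Edge.lo e) (incidence f)) (δ-· (Edge.hi e) (incidence f)))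

  incidence-sum : ∀ {e f : Edge H} {p q r s} →
    δ (Edge.lo f) (Edge.lo e) ≡ p → δ (Edge.hi f) (Edge.lo e) ≡ q → δ (Edge.lo f) (Edge.hi e) ≡ r → δ (Edge.hi f) (Edge.hi e) ≡ s →
    incidence e · incidence f ≡ (p + 1ℚ * q) + 1ℚ * (r + 1ℚ * s)
  incidence-sum {e} {f} refl refl refl refl = incidence-· e f

  incidence-self : ∀ (e : Edge H) → incidence e · incidence e ≡ 2ℚ
  incidence-self e = incidence-sum {e} {e} (δᵢᵢ≡1 (Edge.lo e)) (δ-≢ (lo≢hi e ∘ sym)) (δ-≢ (lo≢hi e)) (δᵢᵢ≡1 (Edge.hi e))

  incidence-disjoint : ∀ (e f : Edge H) → ¬ ShareVertex e f → incidence e · incidence f ≡ 0ℚ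
  incidence-disjoint e f disjoint = incidence-sum {e} {f}
    (δ-≢ (λ eq → disjoint (_ , inj₁ refl , inj₁ (sym eq)))) (δ-≢ (λ eq → disjoint (_ , inj₁ refl , inj₂ (sym eq))))
    (δ-≢ (λ eq → disjoint (_ , inj₂ refl , inj₁ (sym eq)))) (δ-≢ (λ eq → disjoint (_ , inj₂ refl , inj₂ (sym eq))))

  -- Exactly one of the four pairs of ends coincides. Two other pairs differ because an edge has
  -- distinct ends. The last differs because otherwise e = f or, when the upper end of one edge is
  -- the lower end of the other, by transitivity of the order.
  incidence-adjacent : ∀ (e f : Edge H) → e ≢ f → ShareVertex e f → incidence e · incidence f ≡ 1ℚ
  incidence-adjacent e@(edge a b _ _) f@(edge .a d _ _) e≢f (_ , inj₁ refl , inj₁ refl) =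
    incidence-sum {e} {f} (δᵢᵢ≡1 a) (δ-≢ (lo≢hi f ∘ sym)) (δ-≢ (lo≢hi e)) (δ-≢ {i = d} {b} (λ { refl → e≢f refl }))
  incidence-adjacent e@(edge a b a<b _) f@(edge c .a c<a _) e≢f (_ , inj₁ refl , inj₂ refl) =
    incidence-sum {e} {f} (δ-≢ (lo≢hi f)) (δᵢᵢ≡1 a) (δ-≢ (Fin.<⇒≢ (Fin.<-trans (recompute (c Fin.<? a) c<a) (recompute (a Fin.<? b) a<b)))) (δ-≢ (lo≢hi e))
  incidence-adjacent e@(edge a b a<b _) f@(edge .b d b<d _) e≢f (_ , inj₂ refl , inj₁ refl) =
    incidence-sum {e} {f} (δ-≢ (lo≢hi e ∘ sym)) (δ-≢ (Fin.<⇒≢ (Fin.<-trans (recompute (a Fin.<? b) a<b) (recompute (b Fin.<? d) b<d)) ∘ sym)) (δᵢᵢ≡1 b) (δ-≢ (lo≢hi f ∘ sym))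
  incidence-adjacent e@(edge a b _ _) f@(edge c .b _ _) e≢f (_ , inj₂ refl , inj₂ refl) =
    incidence-sum {e} {f} (δ-≢ {i = c} {a} (λ { refl → e≢f refl })) (δ-≢ (lo≢hi e ∘ sym)) (δ-≢ (lo≢hi f)) (δᵢᵢ≡1 b)

-- A + 2I is the Gram matrix of the incidence vectors of the edges.
lineGraph⇒-A⪯2 : ∀ (G : Graph (Fin n)) → IsLineGraph G → neg (adjacency G) ⪯ 2ℚ
lineGraph⇒-A⪯2 {n} G (m , H , f , adj) =
  shift-psd⇒⪯ {M = neg (adjacency G)} {2ℚ} (gram-positiveSemidefinite (λ i → incidence (e i)) λ i j → gram i j (i Fin.≟ j) (Graph._~?_ G i j))
  where
  e : Fin n → Edge H
  e = Inverse.to f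

  e-injective : ∀ {i j} → e i ≡ e j → i ≡ j
  e-injective {i} {j} eᵢ≡eⱼ = trans (sym (Inverse.strictlyInverseʳ f i)) (trans (cong (Inverse.from f) eᵢ≡eⱼ) (Inverse.strictlyInverseʳ f j))

  gram : ∀ i j → Dec (i ≡ j) → Dec (Graph._~_ G i j) → shift 2ℚ (neg (adjacency G)) i j ≡ incidence (e i) · incidence (e j)
  gram i .i (yes refl) _ = trans (cong₂ (λ a b → - - a + 2ℚ * b) (adjacency-≁ G (Graph.~-irrefl G refl)) (δᵢᵢ≡1 i)) (sym (incidence-self (e i)))
  gram i j (no i≢j) (yes i~j) = let eᵢ≢eⱼ , share = Equivalence.to (adj i j) i~j in
    trans (cong₂ (λ a b → - - a + 2ℚ * b) (adjacency-~ G i~j) (δ-≢ i≢j)) (sym (incidence-adjacent (e i) (e j) eᵢ≢eⱼ share))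
  gram i j (no i≢j) (no i≁j) =
    trans (cong₂ (λ a b → - - a + 2ℚ * b) (adjacency-≁ G i≁j) (δ-≢ i≢j))
      (sym (incidence-disjoint (e i) (e j) λ share → i≁j (Equivalence.from (adj i j) (i≢j ∘ e-injective , share))))

-- The simple top eigenvalue and the Salem property

module _ (G : Graph (Fin (suc n))) {v : Fin (suc n)} {t γ : ℚ} (minor⪯t : minor v (adjacency G) ⪯ t)
  (0<γ : 0ℚ < γ) (t+γ<A : Exceeds (adjacency G) (t + γ)) where

  open Bisection (adjacency G) (adjacency-sym G) {t + γ} t+γ<A

  top : ℝ
  top = mkℝ u u-cauchy

  top-eigensequence : Eigensequence (adjacency G) u v
  -- The bisection starts at t + γ, so every lower end keeps the distance γ from t that makes the
  -- linear systems uniformly definite.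
  top-eigensequence = eigensequence v (adjacency-sym G) {t = t} {l = l} 0<γ minor⪯t l₀≤l u-cauchy width-null brackets

  module _ (y : Vector ℝ (suc n)) (μ : ℝ) (Ay≈μy : ∀ i → (adjacencyMatrix G *ᵥ y) i ≈ μ ℝ.* y i) where
    open TopEigenvalue {v = v} {adjacency G} (adjacency-sym G) {t} 0<γ minor⪯t {u} u-cauchy (t+γ≤u G {t} 0<γ t+γ<A) top-eigensequence
      {seqs y} (seqs-bounded y) {seq μ} (cauchy⇒bounded {seq μ} (cauchy μ)) (residual-null G μ y Ay≈μy) public

  top-simple : SimpleEigenvalue (adjacencyMatrix G) top
  -- The factor is the v-coordinate of y, since x has v-coordinate 1.
  top-simple = x , eigenpair G u-cauchy top-eigensequence , λ y (_ , Ay≈λy) → y v , same⇒proportional y top Ay≈λy (λ _ → refl)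
    where
    x : Vector ℝ (suc n)
    x i = mkℝ (λ k → Eigensequence.vec top-eigensequence k i) (Eigensequence.converge top-eigensequence i)

  top-unique : ∀ μ → fromℚ t ℝ.< μ → Eigenvalue (adjacencyMatrix G) μ → μ ≈ top
  -- Equality of reals is tight, so it suffices to refute apartness; apartness supplies the uniform
  -- separation η under which y would tend to 0.
  top-unique μ t<μ (y , (i , yᵢ#0) , Ay≈μy) = ≈-tight {μ} {top} λ μ#λ → let η , 0<η , apart = #⇒eventually-apart {μ} {top} μ#λ in
    apart⇒¬null {y i} yᵢ#0 (null-norm⇒null {x = seqs y} (distinct⇒null y μ Ay≈μy 0<η apart t<μ) i)

  simpleTopEigenvalue : ∃[ λ′ ] fromℚ t ℝ.< λ′ × SimpleEigenvalue (adjacencyMatrix G) λ′ ×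
                        (∀ μ → fromℚ t ℝ.< μ → Eigenvalue (adjacencyMatrix G) μ → μ ≈ λ′)
  simpleTopEigenvalue = top , (γ , 0<γ , 0 , λ k _ → t+γ≤u G {t} 0<γ t+γ<A k) , top-simple , top-unique

theorem9 : ∀ {n : ℕ} (G : Graph (Fin (suc n))) (v : Fin (suc n)) →
    ¬ Cyclotomic G → ¬ Bipartite G → Cyclotomic (G ∖ v) →
    IsLineGraph G → Salem G
theorem9 {n} G v ¬cyclotomic ¬bipartite cyclotomic-v lineGraph =
  [ (λ A⪯2 → contradiction (λ μ ev → -2≤ μ ev , ⪯⇒eigenvalue≤ G 2ℚ A⪯2 μ ev) ¬cyclotomic) , salem ]′ (⪯? (adjacency G) (adjacency-sym G) 2ℚ)
  where
  -2≤ : ∀ μ → Eigenvalue (adjacencyMatrix G) μ → -2ℝ ℝ.≤ μ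
  -2≤ = -2≤eigenvalue G (lineGraph⇒-A⪯2 G lineGraph)

  salem : Exceeds (adjacency G) 2ℚ → Salem G
  salem (w , 2<A) = let γ , 0<γ , 2+γ<A = exceed-gap (adjacency G) {t = 2ℚ} {x = w} 2<A in
    -- Deleting v turns the rational adjacency matrix into its minor at v by definition, so the
    -- bound for the subgraph is already the one required.
    ¬bipartite , simpleTopEigenvalue G {v} {2ℚ} {γ} (cyclotomic⇒⪯2 (G ∖ v) cyclotomic-v) 0<γ (w , 2+γ<A) , -2≤
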